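{- For $n\in\{1,2,3,5,6,7\}$, every asymmetric covering $\mathcal{D}(n,1)$ of the minimum size $D(n,1)$ is banded, and the corresponding union of covering designs of length $n+1$ (obtained by appending a bit to each vector so that all co-weights become even) is unique up to isomorphism. For $n=4$ there are exactly four nonisomorphic asymmetric coverings $\mathcal{D}(4,1)$ of size $D(4,1)=6$, of which exactly two are banded.
   Context: An asymmetric covering $\mathcal{D}(n,1)$ is a set $\mathcal{D}\subseteq\mathbb{F}_2^n$ such that every $v\in\mathbb{F}_2^n$ either lies in $\mathcal{D}$ or is covered by (has support contained in the support of) some $u\in\mathcal{D}$ with $\mathrm{wt}(u)=\mathrm{wt}(v)+1$; $D(n,1)$ is the smallest size of one. It is banded if every $v$ of odd co-weight $n-\mathrm{wt}(v)$ is covered by some $u\in\mathcal{D}$ with $\mathrm{wt}(u)=\mathrm{wt}(v)+1$. Two coverings (or codes, designs) are isomorphic if they differ by a permutation of coordinates.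
   Formalization: As stated the claims fail under one coordinate permutation (n=5,6,7) and under permuting 4 coordinates (n=4). Here uniqueness of the union means each weight's design is unique, with its own permutation, and n=4 coverings are isomorphic when their length-5 extensions are. -}

module Defs where

open import Data.Bool.Base using (Bool; true; false)
open import Data.Fin.Base using (Fin)
open import Data.Fin.Permutation using (Permutation′; _⟨$⟩ʳ_)
open import Data.Fin.Subset using (Subset; _⊆_; ∣_∣)
open import Data.List.Base using (List; length; map; filter)
open import Data.List.Membership.Propositional using (_∈_)
open import Data.List.Relation.Unary.Unique.Propositional using (Unique)
import Data.List.Relation.Unary.Unique.Propositional.Properties as Unique
open import Data.Nat.Base using (ℕ; suc; _+_; _∸_; _≤_; parity)
open import Data.Nat.Properties using (_≟_)
open import Data.Parity.Base using (Parity; 0ℙ; 1ℙ)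
open import Data.Product.Base using (_×_; ∃-syntax)
open import Data.Sum.Base using (_⊎_)
open import Data.Vec.Base using (_∷ʳ_; lookup; tabulate)
open import Data.Vec.Properties using (∷ʳ-injectiveˡ)
open import Function.Bundles using (_⇔_)
open import Relation.Binary.PropositionalEquality using (_≡_)

-- A vector of 𝔽₂ⁿ is identified with its support.  A set of vectors is a
-- duplicate-free list; the order of the list never matters below, since codes
-- are only compared through membership and size.

record Code (n : ℕ) : Set where
  constructor mkCode
  field
    vectors  : List (Subset n)
    distinct : Unique vectors

open Code public

infix 4 _∈ᶜ_

_∈ᶜ_ : ∀ {n} → Subset n → Code n → Set
v ∈ᶜ D = v ∈ vectors D

size : ∀ {n} → Code n → ℕ
size D = length (vectors D)

coweight : ∀ {n} → Subset n → ℕ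
coweight {n} v = n ∸ ∣ v ∣

CoveredBy : ∀ {n} → Code n → Subset n → Set
CoveredBy D v = ∃[ u ] (u ∈ᶜ D × v ⊆ u × ∣ u ∣ ≡ ∣ v ∣ + 1)

IsAsymmetricCovering : ∀ {n} → Code n → Set
IsAsymmetricCovering {n} D = (v : Subset n) → v ∈ᶜ D ⊎ CoveredBy D v

IsMinimum : ∀ {n} → Code n → Set
IsMinimum {n} D =
  IsAsymmetricCovering D ×
  ((E : Code n) → IsAsymmetricCovering E → size D ≤ size E)

-- D(n,1) = m.
MinimumSizeIs : ℕ → ℕ → Set
MinimumSizeIs n m = ∃[ D ] (IsMinimum {n} D × size D ≡ m)

IsBanded : ∀ {n} → Code n → Set
IsBanded {n} D = (v : Subset n) → parity (coweight v) ≡ 1ℙ → CoveredBy D v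

-- A bit 0 raises the co-weight by one, a bit 1 leaves it unchanged.
bitFor : Parity → Bool
bitFor 0ℙ = true
bitFor 1ℙ = false

extendVector : ∀ {n} → Subset n → Subset (suc n)
extendVector v = v ∷ʳ bitFor (parity (coweight v))

extend : ∀ {n} → Code n → Code (suc n)
extend D = mkCode
  (map extendVector (vectors D))
  (Unique.map⁺ (λ {u} {v} → ∷ʳ-injectiveˡ u v) (distinct D))

layer : ∀ {n} → ℕ → Code n → Code n
layer k D = mkCode
  (filter (λ v → ∣ v ∣ ≟ k) (vectors D))
  (Unique.filter⁺ (λ v → ∣ v ∣ ≟ k) (distinct D))

-- A covering design C(v,k,t): k-subsets of a v-set (the blocks) such that
-- every t-subset lies in a block.
IsCoveringDesign : ∀ {v} (k t : ℕ) → Code v → Set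
IsCoveringDesign {v} k t B =
  ((b : Subset v) → b ∈ᶜ B → ∣ b ∣ ≡ k) ×
  ((T : Subset v) → ∣ T ∣ ≡ t → ∃[ b ] (b ∈ᶜ B × T ⊆ b))

-- All co-weights are even, and for each weight k + 1 of even co-weight the
-- vectors of that weight form a C(m,k+1,k).
IsUnionOfCoveringDesigns : ∀ {m} → Code m → Set
IsUnionOfCoveringDesigns {m} U =
  ((u : Subset m) → u ∈ᶜ U → parity (coweight u) ≡ 0ℙ) ×
  (∀ k → suc k ≤ m → parity (m ∸ suc k) ≡ 0ℙ →
    IsCoveringDesign (suc k) k (layer (suc k) U))

permute : ∀ {n} → Permutation′ n → Subset n → Subset n
permute π v = tabulate (λ i → lookup v (π ⟨$⟩ʳ i))

infix 4 _≅_ _≅ᴱ_ _≅ᵁ_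

_≅_ : ∀ {n} → Code n → Code n → Set
_≅_ {n} D E =
  ∃[ π ] ((v : Subset n) → v ∈ᶜ D ⇔ permute {n} π v ∈ᶜ E)

-- Isomorphism of asymmetric coverings of length n is taken in the extended
-- form, with all n + 1 coordinates permuted.  Permuting the original n
-- coordinates only is strictly finer: it splits the minimum coverings of
-- length 4 into eight classes rather than four, and those of length 2,
-- {11,00} and {11,10}, into two.
_≅ᴱ_ : ∀ {n} → Code n → Code n → Set
D ≅ᴱ E = extend D ≅ extend E

-- Unions of covering designs are isomorphic when they are made up of
-- isomorphic designs, one for each weight.  The permutation may depend on the
-- weight: the designs of a union can be chosen independently, so their relative
-- position is not determined.  In length 6, for instance, the minimum C(6,4,3)
-- consists of the complements of the edges of two disjoint triangles and the
-- minimum C(6,2,1) is a perfect matching, which may have either one or three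
-- edges joining the triangles.
_≅ᵁ_ : ∀ {m} → Code m → Code m → Set
U ≅ᵁ V = ∀ k → layer k U ≅ layer k V

-- The elements satisfying P fall into exactly k classes of _~_: a complete
-- system of k pairwise inequivalent representatives.
record ClassCount {A : Set} (_~_ : A → A → Set) (P : A → Set) (k : ℕ) : Set where
  field
    rep          : Fin k → A
    rep-P        : ∀ i → P (rep i)
    inequivalent : ∀ i j → rep i ~ rep j → i ≡ j
    complete     : ∀ a → P a → ∃[ i ] (a ~ rep i)

-- The unions of covering designs of length n + 1 arising from minimum
-- coverings of length n.
IsMinimumUnion : ∀ {n} → Code (suc n) → Set
IsMinimumUnion {n} U = ∃[ D ] (IsMinimum {n} D × U ≡ extend D)

{-# OPTIONS --safe #-}

-- Write x_u for the indicator of a covering D.  Each word v gives an inequality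
-- x_v + Σ x_u ≥ 1, summed over the words u covering v, and Chvátal–Gomory steps
-- (combine, divide, round up) derive all further bounds from these.  Let S be the
-- set of points p with [n] - p in D.  The complements of the words of weight n - 2
-- in D are the edges of a graph on [n] in which the points outside S form a clique.
-- For n = 5, 6, 7 the derived bounds force |S| = 2, |S| = 2 or 3, |S| = 3
-- respectively if D is minimum, and S to be a clique too: on S + ∞ and the other
-- points this is the complement of Turán's bipartite graph.  With a parity
-- argument for the lower weights, the bounds also give bandedness, so the extended
-- code is a union of covering designs, all of minimum size.  Besides the Turán
-- layer these are Steiner systems, which an exhaustive search classifies.  For
-- n ≤ 4 the coverings themselves are enumerated.
module Submission where

open import Defs
open import Data.Bool.Base using (Bool; true; false; _∧_; _∨_; not; if_then_else_; T)
open import Data.Bool.ListAction using (any; all)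
import Data.Bool.Properties as Bool
open import Data.Bool.Properties using (T-∧; T-∨; T-≡; T-not-≡)
open import Data.Fin.Base as Fin using (Fin)
open import Data.Fin.Patterns using (0F; 1F; 2F; 3F)
import Data.Fin.Permutation as Perm
open import Data.Fin.Permutation using (Permutation′; permutation; _⟨$⟩ʳ_; _⟨$⟩ˡ_)
import Data.Fin.Properties as Fin
open import Data.Fin.Subset using (Subset; _⊆_; ∣_∣; ⊥; ⊤; ∁; _∩_; _∪_)
open import Data.Fin.Subset.Properties using (drop-∷-⊆; s⊆s; out⊆; ∣p∣≤n; ∣⊥∣≡0; ⊆-min)
import Data.List.Base as List
open import Data.List.Base using (List; _∷_; []; _++_; map; length; filter; filterᵇ;
  concatMap; foldr; upTo; downFrom; null; allFin)
open import Data.List.Membership.Propositional using (_∈_; _∉_; find)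
open import Data.List.Membership.Propositional.Properties
open import Data.List.Properties using (≡-dec; length-map; length-++-sucʳ)
open import Data.List.Relation.Unary.All as All using (All; []; _∷_)
import Data.List.Relation.Unary.All.Properties as All
open import Data.List.Relation.Unary.AllPairs using ([]; _∷_)
open import Data.List.Relation.Unary.Any as Any using (Any; here; there)
import Data.List.Relation.Unary.Any.Properties as Any
open import Data.List.Relation.Unary.Unique.Propositional using (Unique)
import Data.List.Relation.Unary.Unique.Propositional.Properties as Unique
import Data.List.Relation.Binary.Subset.Propositional.Properties as Subset
open import Data.Maybe.Base using (Maybe; just; nothing)
open import Data.Nat.Base
open import Data.Nat.DivMod using (_/_; _%_)
open import Data.Nat.Properties
open import Data.Nat.Solver using (module +-*-Solver)
open import Data.Parity.Base using (Parity; 0ℙ; 1ℙ)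
open import Data.Product.Base using (_×_; _,_; proj₁; proj₂; ∃-syntax)
open import Data.Product.Properties using () renaming (≡-dec to ×-≡-dec)
open import Data.Sum.Base using (inj₁; inj₂; [_,_]′)
open import Data.Unit.Base using (tt)
open import Data.Vec.Base as Vec using (Vec; []; _∷_; _∷ʳ_; lookup; tabulate)
open import Data.Vec.Properties using (tabulate-∘; tabulate∘lookup; tabulate-cong; lookup∘tabulate)
open import Function.Base using (_∘_; id)
open import Function.Bundles using (Equivalence; mk⇔)
open import Relation.Binary.PropositionalEquality
open import Relation.Nullary.Decidable using (Dec; does; toWitness; fromWitness; isYes; yes; no; T?; _→-dec_)
open import Relation.Nullary.Negation using (¬_; contradiction)

open import Data.List.Membership.DecPropositional (×-≡-dec _≟_ (×-≡-dec (≡-dec _≟_) _≟_))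
  using () renaming (_∈?_ to _∈ᶠ?_)

-- Booleans and sums over lists.

T≡ : ∀ {b} → b ≡ true → T b
T≡ = Equivalence.from T-≡

implied : ∀ {a b} → T (not a ∨ b) → T a → T b
implied {true} t _ = t

all-∈ : ∀ {A : Set} (p : A → Bool) {xs} → T (all p xs) → ∀ {x} → x ∈ xs → T (p x)
all-∈ p {xs} t = All.lookup (All.all⁺ p xs t)

∧⁻ : ∀ {x y} → T (x ∧ y) → T x × T y
∧⁻ = Equivalence.to T-∧

total : ∀ {A : Set} → (A → ℕ) → List A → ℕ
total f []       = 0
total f (x ∷ xs) = f x + total f xs

module _ {A : Set} where

  total-mono : ∀ {f g : A → ℕ} xs → (∀ {x} → x ∈ xs → f x ≤ g x) → total f xs ≤ total g xs
  total-mono []       f≤g = z≤n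
  total-mono (x ∷ xs) f≤g = +-mono-≤ (f≤g (here refl)) (total-mono xs (f≤g ∘ there))

  total-one : ∀ (xs : List A) → total (λ _ → 1) xs ≡ length xs
  total-one []       = refl
  total-one (x ∷ xs) = cong suc (total-one xs)

  total-+ : ∀ (f g : A → ℕ) xs → total (λ x → f x + g x) xs ≡ total f xs + total g xs
  total-+ f g []       = refl
  total-+ f g (x ∷ xs) rewrite total-+ f g xs =
    solve 4 (λ a b c d → (a :+ b) :+ (c :+ d) := (a :+ c) :+ (b :+ d)) refl
      (f x) (g x) (total f xs) (total g xs)
    where open +-*-Solver

  total-* : ∀ k (f : A → ℕ) xs → total (λ x → k * f x) xs ≡ k * total f xs
  total-* k f []       = sym (*-zeroʳ k)
  total-* k f (x ∷ xs) rewrite total-* k f xs = sym (*-distribˡ-+ k (f x) (total f xs))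

  total-∈ : ∀ (f : A → ℕ) {x xs} → x ∈ xs → f x ≤ total f xs
  total-∈ f (here refl)          = m≤m+n _ _
  total-∈ f (there {x = y} x∈xs) = ≤-trans (total-∈ f x∈xs) (m≤n+m _ (f y))

  total-∈₂ : ∀ (f : A → ℕ) {x y xs} → x ∈ xs → y ∈ xs → x ≢ y → f x + f y ≤ total f xs
  total-∈₂ f (here refl) (here refl) x≢y = contradiction refl x≢y
  total-∈₂ f (here refl) (there y∈)  x≢y = +-monoʳ-≤ _ (total-∈ f y∈)
  total-∈₂ f {x} {y} {xs = _ ∷ xs} (there x∈) (here refl) x≢y =
    subst (_≤ f y + total f xs) (+-comm (f y) (f x)) (+-monoʳ-≤ (f y) (total-∈ f x∈))
  total-∈₂ f (there {x = z} x∈) (there y∈) x≢y = ≤-trans (total-∈₂ f x∈ y∈ x≢y) (m≤n+m _ (f z))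

-- Words as Boolean vectors: inclusion, equality, enumeration by weight.

infix 4 _⊑_ _==_

_⊑_ : ∀ {n} → Subset n → Subset n → Bool
[]          ⊑ []          = true
(true ∷ v)  ⊑ (false ∷ u) = false
(true ∷ v)  ⊑ (true ∷ u)  = v ⊑ u
(false ∷ v) ⊑ (_ ∷ u)     = v ⊑ u

_==_ : ∀ {n} → Subset n → Subset n → Bool
[]          == []          = true
(true ∷ v)  == (true ∷ u)  = v == u
(false ∷ v) == (false ∷ u) = v == u
(_ ∷ v)     == (_ ∷ u)     = false

⊑⇒⊆ : ∀ {n} (v u : Subset n) → T (v ⊑ u) → v ⊆ u
⊑⇒⊆ (true ∷ v)  (true ∷ u)  v⊑u = s⊆s (⊑⇒⊆ v u v⊑u)
⊑⇒⊆ (false ∷ v) (x ∷ u)     v⊑u = out⊆ (⊑⇒⊆ v u v⊑u)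

⊆⇒⊑ : ∀ {n} (v u : Subset n) → v ⊆ u → T (v ⊑ u)
⊆⇒⊑ []          []          v⊆u = tt
⊆⇒⊑ (true ∷ v)  (true ∷ u)  v⊆u = ⊆⇒⊑ v u (drop-∷-⊆ v⊆u)
⊆⇒⊑ (true ∷ v)  (false ∷ u) v⊆u with v⊆u Vec.here
... | ()
⊆⇒⊑ (false ∷ v) (x ∷ u)     v⊆u = ⊆⇒⊑ v u (drop-∷-⊆ v⊆u)

⊑-refl : ∀ {n} (v : Subset n) → T (v ⊑ v)
⊑-refl v = ⊆⇒⊑ v v id

==⇒≡ : ∀ {n} (v u : Subset n) → T (v == u) → v ≡ u
==⇒≡ []          []          _ = refl
==⇒≡ (true ∷ v)  (true ∷ u)  p = cong (true ∷_) (==⇒≡ v u p)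
==⇒≡ (false ∷ v) (false ∷ u) p = cong (false ∷_) (==⇒≡ v u p)

==-refl : ∀ {n} (v : Subset n) → T (v == v)
==-refl []          = tt
==-refl (true ∷ v)  = ==-refl v
==-refl (false ∷ v) = ==-refl v

_∈ᵇ_ : ∀ {n} → Subset n → List (Subset n) → Bool
v ∈ᵇ l = any (v ==_) l

∈ᵇ⇒∈ : ∀ {n} (v : Subset n) l → T (v ∈ᵇ l) → v ∈ l
∈ᵇ⇒∈ v l p = Any.map (==⇒≡ v _) (Any.any⁻ (v ==_) l p)

∈⇒∈ᵇ : ∀ {n} {v : Subset n} {l} → v ∈ l → T (v ∈ᵇ l)
∈⇒∈ᵇ {v = v} v∈l = Any.any⁺ (v ==_) (Any.map (λ where refl → ==-refl v) v∈l)

allSubsets : ∀ {n} → (Subset n → Bool) → Bool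
allSubsets {zero}  p = p []
allSubsets {suc n} p = allSubsets (λ v → p (false ∷ v)) ∧ allSubsets (λ v → p (true ∷ v))

allSubsets⁻ : ∀ {n} (p : Subset n → Bool) → T (allSubsets p) → ∀ v → T (p v)
allSubsets⁻ {zero}  p t []          = t
allSubsets⁻ {suc n} p t (false ∷ v) = allSubsets⁻ (λ v → p (false ∷ v)) (proj₁ (∧⁻ t)) v
allSubsets⁻ {suc n} p t (true ∷ v)  = allSubsets⁻ (λ v → p (true ∷ v)) (proj₂ (∧⁻ t)) v

subsets : (n k : ℕ) → List (Subset n)
subsets zero    zero    = [] ∷ []
subsets zero    (suc k) = []
subsets (suc n) zero    = map (false ∷_) (subsets n zero)
subsets (suc n) (suc k) = map (true ∷_) (subsets n k) ++ map (false ∷_) (subsets n (suc k))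

∈-subsets⁺ : ∀ {n} (v : Subset n) → v ∈ subsets n ∣ v ∣
∈-subsets⁺ []          = here refl
∈-subsets⁺ (true ∷ v)  = ∈-++⁺ˡ (∈-map⁺ (true ∷_) (∈-subsets⁺ v))
∈-subsets⁺ {suc n} (false ∷ v) with ∣ v ∣ | ∈-subsets⁺ v
... | zero  | v∈ = ∈-map⁺ (false ∷_) v∈
... | suc k | v∈ = ∈-++⁺ʳ (map (true ∷_) (subsets n k)) (∈-map⁺ (false ∷_) v∈)

∈-subsets⁻ : ∀ n k {v : Subset n} → v ∈ subsets n k → ∣ v ∣ ≡ k
∈-subsets⁻ zero    zero    (here refl) = refl
∈-subsets⁻ (suc n) zero    v∈ with ∈-map⁻ (false ∷_) v∈
... | w , w∈ , refl = ∈-subsets⁻ n zero w∈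
∈-subsets⁻ (suc n) (suc k) v∈ with ∈-++⁻ (map (true ∷_) (subsets n k)) v∈
... | inj₁ v∈₁ with ∈-map⁻ (true ∷_) v∈₁
...   | w , w∈ , refl = cong suc (∈-subsets⁻ n k w∈)
∈-subsets⁻ (suc n) (suc k) v∈ | inj₂ v∈₂ with ∈-map⁻ (false ∷_) v∈₂
...   | w , w∈ , refl = ∈-subsets⁻ n (suc k) w∈

-- Cutting planes

-- The inequality Σ_{u ⊇ base} profile(∣u∣ - ∣base∣) · x_u ≥ bound for the
-- indicator x of a code; entries beyond the end of the profile are 0.
record Cut (n : ℕ) : Set where
  constructor cut
  field
    base    : Subset n
    profile : List ℕ
    bound   : ℕ

open Cut

entry : List ℕ → ℕ → ℕ
entry []       _       = 0
entry (x ∷ xs) zero    = x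
entry (x ∷ xs) (suc i) = entry xs i

coef : ∀ {n} → Cut n → Subset n → ℕ
-- The truncated difference is exact here, since `R ⊑ u` gives `∣ R ∣ ≤ ∣ u ∣`.
coef (cut R g _) u = if R ⊑ u then entry g (∣ u ∣ ∸ ∣ R ∣) else 0

Valid : ∀ {n} → List (Subset n) → Cut n → Set
Valid xs c = bound c ≤ total (coef c) xs

coef-⊒ : ∀ {n} (R u : Subset n) g b i → T (R ⊑ u) → ∣ u ∣ ≡ i + ∣ R ∣ → coef (cut R g b) u ≡ entry g i
coef-⊒ R u g b i R⊑u eq with R ⊑ u
... | true rewrite eq = cong (entry g) (m+n∸n≡m i ∣ R ∣)

-- The single word `u` already attains the bound, and the other words contribute nothing negative.
valid-by : ∀ {n} (xs : List (Subset n)) R u g i → u ∈ xs → T (R ⊑ u) → ∣ u ∣ ≡ i + ∣ R ∣ →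
           Valid xs (cut R g (entry g i))
valid-by xs R u g i u∈ R⊑u eq =
  subst (_≤ total (coef c) xs) (coef-⊒ R u g (entry g i) i R⊑u eq) (total-∈ (coef c) u∈)
  where c = cut R g (entry g i)

Combination : ℕ → Set
Combination n = List (ℕ × Cut n)

combine : ∀ {n} → Combination n → Subset n → ℕ
combine []             u = 0
combine ((k , c) ∷ ds) u = k * coef c u + combine ds u

combinedBound : ∀ {n} → Combination n → ℕ
combinedBound []             = 0
combinedBound ((k , c) ∷ ds) = k * bound c + combinedBound ds

ValidAll : ∀ {n} → List (Subset n) → Combination n → Set
ValidAll xs = All (Valid xs ∘ proj₂)

combine-valid : ∀ {n} (xs : List (Subset n)) {ds} → ValidAll xs ds → combinedBound ds ≤ total (combine ds) xs
combine-valid xs []                           = z≤n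
combine-valid xs {(k , c) ∷ ds} (v ∷ vs) = begin
  k * bound c + combinedBound ds                          ≤⟨ +-mono-≤ (*-monoʳ-≤ k v) (combine-valid xs vs) ⟩
  k * total (coef c) xs + total (combine ds) xs           ≡⟨ cong (_+ _) (total-* k (coef c) xs) ⟨
  total (λ u → k * coef c u) xs + total (combine ds) xs   ≡⟨ total-+ (λ u → k * coef c u) (combine ds) xs ⟨
  total (combine ((k , c) ∷ ds)) xs                       ∎
  where open ≤-Reasoning

-- A Chvátal–Gomory step: off the words known to be absent, ds divided by k
-- is dominated by c, and its bound divided by k rounds up to that of c.
follows : ∀ {n} → List (Subset n) → ℕ → Combination n → Cut n → Bool
follows absent k ds c =
  (k * bound c <ᵇ k + combinedBound ds) ∧
  allSubsets (λ u → (combine ds u ≤ᵇ k * coef c u) ∨ (u ∈ᵇ absent))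

follows-valid : ∀ {n} (xs absent : List (Subset n)) {k ds c} → T (follows absent k ds c) →
                (∀ {u} → u ∈ xs → u ∉ absent) → ValidAll xs ds → Valid xs c
follows-valid {n} xs absent {k} {ds} {c} t avoids vs =
  -- The rounding up: the chain gives k · bound < k · (1 + total), and over the integers the bound
  -- is then at most the total.
  ≤-pred (*-cancelˡ-< k _ _ (begin-strict
    k * bound c                      <⟨ <ᵇ⇒< _ _ (proj₁ (∧⁻ t)) ⟩
    k + combinedBound ds             ≤⟨ +-monoʳ-≤ k (combine-valid xs vs) ⟩
    k + total (combine ds) xs        ≤⟨ +-monoʳ-≤ k (total-mono xs dominated) ⟩
    k + total (λ u → k * coef c u) xs ≡⟨ cong (k +_) (total-* k (coef c) xs) ⟩
    k + k * total (coef c) xs        ≡⟨ *-suc k _ ⟨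
    k * suc (total (coef c) xs)      ∎))
  where
  open ≤-Reasoning
  dominated : ∀ {u} → u ∈ xs → combine ds u ≤ k * coef c u
  dominated {u} u∈xs
    with Equivalence.to T-∨ (allSubsets⁻ (λ u → (combine ds u ≤ᵇ k * coef c u) ∨ (u ∈ᵇ absent)) (proj₂ (∧⁻ t)) u)
  ... | inj₁ le = ≤ᵇ⇒≤ _ _ le
  ... | inj₂ u∈ = contradiction (∈ᵇ⇒∈ u absent u∈) (avoids u∈xs)

-- The covering inequalities are symmetric in the coordinates, so a derived bound is stated for all
-- bases of weight `w` at once.
Family : Set
Family = ℕ × List ℕ × ℕ

Holds : ∀ {n} → List (Subset n) → Family → Set
Holds {n} xs (w , g , b) = (R : Subset n) → ∣ R ∣ ≡ w → Valid xs (cut R g b)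

-- k times the cuts of a family based at the R with prescribed numbers of
-- points in the blocks of a partition.
Entry : Set
Entry = ℕ × Family × List ℕ

known : List Family → List Entry → Bool
known fs = all (λ e → isYes (proj₁ (proj₂ e) ∈ᶠ? fs))

meet : ∀ {n} → Subset n → Subset n → ℕ
meet []          []          = 0
meet (true ∷ v)  (true ∷ u)  = suc (meet v u)
meet (true ∷ v)  (false ∷ u) = meet v u
meet (false ∷ v) (_ ∷ u)     = meet v u

hasType : ∀ {n} → List (Subset n) → List ℕ → Subset n → Bool
hasType (B ∷ Bs) (i ∷ is) R = (meet B R ≡ᵇ i) ∧ hasType Bs is R
-- When either list runs out the remaining conditions are dropped; the type `[]` thus selects every
-- base.
hasType _        _        R = true

instances : ∀ {n} → List (Subset n) → Entry → Combination n
instances {n} Bs (k , (w , g , b) , is) =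
  map (λ R → k , cut R g b) (filterᵇ (hasType Bs is) (subsets n w))

instances-valid : ∀ {n} (xs : List (Subset n)) {fs} Bs es → All (Holds xs) fs →
                  T (known fs es) → ValidAll xs (concatMap (instances Bs) es)
instances-valid xs Bs []       hs t = []
instances-valid {n} xs {fs} Bs ((k , f@(w , g , b) , is) ∷ es) hs t =
  All.++⁺ (All.map⁺ (All.tabulate λ {R} R∈ →
             All.lookup hs (toWitness {a? = f ∈ᶠ? fs} (proj₁ (∧⁻ t))) R
               (∈-subsets⁻ n w (proj₁ (∈-filter⁻ (T? ∘ hasType Bs is) {xs = subsets n w} R∈)))))
          (instances-valid xs Bs es hs (proj₂ (∧⁻ t)))

record Step : Set where
  constructor step
  field
    conclusion : Family
    divisor    : ℕ
    premises   : List Entry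

after : List Family → List Step → List Family
after fs []                = fs
after fs (step f _ _ ∷ ss) = after (f ∷ fs) ss

-- Symmetry is not invoked: a step is evaluated at every base `R` of weight `w`, with the premises
-- selected by how many points their bases share with `R`.
correct : ℕ → List Family → List Step → Bool
correct n fs []                                = true
correct n fs (step f@(w , g , b) k es ∷ ss) =
  (known fs es ∧ all (λ R → follows [] k (concatMap (instances (R ∷ [])) es) (cut R g b)) (subsets n w)) ∧
  correct n (f ∷ fs) ss

after-holds : ∀ {n} (xs : List (Subset n)) {fs} ss → T (correct n fs ss) →
              All (Holds xs) fs → All (Holds xs) (after fs ss)
after-holds xs []                              t hs = hs
after-holds {n} xs {fs} (step f@(w , g , b) k es ∷ ss) t hs =
  after-holds xs ss (proj₂ (∧⁻ t)) (holds ∷ hs)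
  where
  t₁ = ∧⁻ {known fs es} (proj₁ (∧⁻ t))
  holds : Holds xs f
  holds R refl =
    follows-valid xs [] {k} {concatMap (instances (R ∷ [])) es} {cut R g b}
      (All.lookup (All.all⁺ _ (subsets n w) (proj₂ t₁)) (∈-subsets⁺ R)) (λ _ ())
      (instances-valid xs (R ∷ []) es hs (proj₁ t₁))

-- This is x_u ≥ 1: a word containing `u` with the same weight is `u` itself.
member : ∀ {n} → Subset n → Cut n
member u = cut u (1 ∷ []) 1

member-valid : ∀ {n} {xs : List (Subset n)} {u} → u ∈ xs → Valid xs (member u)
member-valid {xs = xs} {u} u∈ = valid-by xs u u (1 ∷ []) 0 u∈ (⊑-refl u) refl

-- Known members make up for what the other cuts leave of the weight k.
fill : ∀ {n} → ℕ → List (Subset n) → Combination n → Combination n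
fill k present ds = map (λ u → k ∸ combine ds u , member u) present ++ ds

fill-valid : ∀ {n} {xs : List (Subset n)} {k} {present} {ds} → (∀ {u} → u ∈ present → u ∈ xs) →
             ValidAll xs ds → ValidAll xs (fill k present ds)
fill-valid p⊆ vs = All.++⁺ (All.map⁺ (All.tabulate (member-valid ∘ p⊆))) vs

weights : ∀ {n} → List ℕ → ℕ → Cut n
weights = cut ⊥

sizeCut : ∀ n → ℕ → Cut n
sizeCut n = weights (List.replicate (suc n) 1)

entry-replicate : ∀ k i → entry (List.replicate k 1) i ≤ 1
entry-replicate zero    i       = z≤n
entry-replicate (suc k) zero    = ≤-refl
entry-replicate (suc k) (suc i) = entry-replicate k i

sizeCut-valid : ∀ {n} (xs : List (Subset n)) {N} → Valid xs (sizeCut n N) → N ≤ length xs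
sizeCut-valid {n} xs {N} v = ≤-trans v (subst (total _ xs ≤_) (total-one xs) (total-mono xs λ {u} _ → le u))
  where
  le : ∀ u → coef (sizeCut n N) u ≤ 1
  le u with ⊥ ⊑ u
  ... | true  = entry-replicate (suc n) (∣ u ∣ ∸ ∣ ⊥ {n} ∣)
  ... | false = z≤n

-- Case trees on the membership of words.

record Refutation (n : ℕ) : Set where
  constructor refutation
  field
    blocks   : List (Subset n)
    divisor  : ℕ
    premises : List Entry

refutes : ∀ {n} → List Family → ℕ → (present absent : List (Subset n)) → Refutation n → Bool
refutes {n} fs N present absent (refutation Bs k es) =
  known fs es ∧ follows absent k (fill k present (concatMap (instances Bs) es)) (sizeCut n N)

-- The first subtree of a `branch` treats the codes containing the word, the second the others. An
-- `accept` leaf is a case that survives; only its present words are passed on.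
data Tree (n : ℕ) : Set where
  branch : Subset n → Tree n → Tree n → Tree n
  refute : Refutation n → Tree n
  accept : Tree n

closes : ∀ {n} → List Family → ℕ → (present absent : List (Subset n)) → Tree n → Bool
closes fs N present absent (branch u t₁ t₀) =
  closes fs N (u ∷ present) absent t₁ ∧ closes fs N present (u ∷ absent) t₀
closes fs N present absent (refute r) = refutes fs N present absent r
closes fs N present absent accept     = true

accepted : ∀ {n} → List (Subset n) → Tree n → List (List (Subset n))
accepted present (branch u t₁ t₀) = accepted (u ∷ present) t₁ ++ accepted present t₀
accepted present (refute r)       = []
accepted present accept           = present ∷ []

-- The code itself selects a path through the tree. The path cannot end in `refute`, where the size
-- would be at least `N`.
closes-sound : ∀ {n} {xs : List (Subset n)} {fs N} (t : Tree n) {present absent} →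
               T (closes fs N present absent t) → All (Holds xs) fs → length xs < N →
               (∀ {u} → u ∈ present → u ∈ xs) → (∀ {u} → u ∈ absent → u ∉ xs) →
               ∃[ l ] (l ∈ accepted present t × (∀ {u} → u ∈ l → u ∈ xs))
closes-sound {n} {xs} (branch u t₁ t₀) {present} ok hs small p⊆ a⊈ with any (u ==_) xs in eq
... | true  =
  let u∈ = ∈ᵇ⇒∈ u xs (T≡ eq)
      l , l∈ , l⊆ = closes-sound t₁ (proj₁ (∧⁻ ok)) hs small
                      (λ where (here refl) → u∈ ; (there v∈) → p⊆ v∈) a⊈
  in l , ∈-++⁺ˡ l∈ , l⊆
... | false =
  let l , l∈ , l⊆ = closes-sound t₀ (proj₂ (∧⁻ ok)) hs small p⊆
                      (λ where (here refl) u∈ → subst T eq (∈⇒∈ᵇ u∈) ; (there v∈) → a⊈ v∈)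
  in l , ∈-++⁺ʳ (accepted (u ∷ present) t₁) l∈ , l⊆
closes-sound {n} {xs} {fs} {N} (refute (refutation Bs k es)) {present} {absent} ok hs small p⊆ a⊈ =
  contradiction (sizeCut-valid xs (follows-valid xs absent {k} {fill k present ds} {sizeCut n N}
    (proj₂ (∧⁻ {known fs es} ok)) (λ u∈ u∈a → a⊈ u∈a u∈)
    (fill-valid {k = k} {ds = ds} p⊆ (instances-valid xs Bs es hs (proj₁ (∧⁻ ok)))))) (<⇒≱ small)
  where ds = concatMap (instances Bs) es
closes-sound accept {present} ok hs small p⊆ a⊈ = present , here refl , p⊆

-- Coverings

cover : ℕ → Family
cover w = w , 1 ∷ 1 ∷ [] , 1

covers : ℕ → List Family
covers n = map cover (upTo (suc n))

covers-hold : ∀ {n} (D : Code n) → IsAsymmetricCovering D → All (Holds (vectors D)) (covers n)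
covers-hold {n} D covering = All.map⁺ (All.tabulate λ {w} _ → holds w)
  where
  holds : ∀ w → Holds (vectors D) (cover w)
  holds w v _ with covering v
  ... | inj₁ v∈                  = valid-by (vectors D) v v (1 ∷ 1 ∷ []) 0 v∈ (⊑-refl v) refl
  ... | inj₂ (u , u∈ , v⊆u , eq) =
    valid-by (vectors D) v u (1 ∷ 1 ∷ []) 1 u∈ (⊆⇒⊑ v u v⊆u) (trans eq (+-comm ∣ v ∣ 1))

-- Duplicate-free lists

remove-middle : ∀ {A : Set} (as : List A) {bs x y} → y ∈ as ++ x ∷ bs → y ≢ x → y ∈ as ++ bs
remove-middle as y∈ y≢x with ∈-++⁻ as y∈
... | inj₁ y∈as         = ∈-++⁺ˡ y∈as
... | inj₂ (here y≡x)   = contradiction y≡x y≢x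
... | inj₂ (there y∈bs) = ∈-++⁺ʳ as y∈bs

unique-length : ∀ {A : Set} {xs ys : List A} → Unique xs → (∀ {x} → x ∈ xs → x ∈ ys) → length xs ≤ length ys
unique-length []           xs⊆ys = z≤n
unique-length {xs = x ∷ xs} (x∉ ∷ u) xs⊆ys with ∈-∃++ (xs⊆ys (here refl))
... | as , bs , refl = subst (suc (length xs) ≤_) (sym (length-++-sucʳ as x bs))
  (s≤s (unique-length u λ y∈ → remove-middle as (xs⊆ys (there y∈)) λ where refl → All.lookup x∉ y∈ refl))

-- A missing `y` could be added to `xs`, giving a duplicate-free list inside `ys` that is longer
-- than `ys`.
saturated : ∀ {n} {xs ys : List (Subset n)} → Unique xs → (∀ {x} → x ∈ xs → x ∈ ys) →
            length ys ≤ length xs → ∀ {y} → y ∈ ys → y ∈ xs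
saturated {xs = xs} u xs⊆ys len {y} y∈ with y ∈ᵇ xs in eq
... | true  = ∈ᵇ⇒∈ y xs (T≡ eq)
... | false = contradiction
  (≤-trans (unique-length (y∉ ∷ u) λ where (here refl) → y∈ ; (there x∈) → xs⊆ys x∈) len) 1+n≰n
  where
  y∉ = All.tabulate λ x∈ y≡x → subst T eq (∈⇒∈ᵇ (subst (_∈ xs) (sym y≡x) x∈))

distinctᵇ : ∀ {n} → List (Subset n) → Bool
distinctᵇ []       = true
distinctᵇ (x ∷ xs) = not (x ∈ᵇ xs) ∧ distinctᵇ xs

distinctᵇ⇒Unique : ∀ {n} (xs : List (Subset n)) → T (distinctᵇ xs) → Unique xs
distinctᵇ⇒Unique []       t = []
distinctᵇ⇒Unique (x ∷ xs) t =
  All.tabulate (λ y∈ x≡y → subst T (Equivalence.to T-not-≡ (proj₁ (∧⁻ t))) (∈⇒∈ᵇ (subst (_∈ xs) (sym x≡y) y∈))) ∷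
  distinctᵇ⇒Unique xs (proj₂ (∧⁻ t))

-- Isomorphisms

refine : ∀ {m j} → Fin m → List (Subset m × List (Vec Bool (suc j))) → List (Subset m × List (Vec Bool j))
refine i = map λ where (v , cs) → v , map Vec.tail (filterᵇ (λ c → does (Vec.head c Bool.≟ lookup v i)) cs)

-- Orders of the coordinates in which each word reads as one of the words paired
-- with it; the first coordinates of these are consumed as the order is chosen.
arrangements : ∀ {m} j → List (Subset m × List (Vec Bool j)) → List (Fin m) → List (Vec (Fin m) j)
arrangements zero    st free = [] ∷ []
arrangements (suc j) st free = concatMap
  (λ i → let st′ = refine i st in
    if all (not ∘ null ∘ proj₂) st′
    then map (i ∷_) (arrangements j st′ (filterᵇ (λ k → not (does (k Fin.≟ i))) free))
    else [])
  free

surjective? : ∀ {m} (ρ : Vec (Fin m) m) → Dec (∀ i → ∃[ j ] lookup ρ j ≡ i)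
surjective? ρ = Fin.all? λ i → Fin.any? λ j → lookup ρ j Fin.≟ i

injective? : ∀ {m} (ρ : Vec (Fin m) m) → Dec (∀ i j → lookup ρ i ≡ lookup ρ j → i ≡ j)
injective? ρ = Fin.all? λ i → Fin.all? λ j → (lookup ρ i Fin.≟ lookup ρ j) →-dec (i Fin.≟ j)

isPermᵇ : ∀ {m} → Vec (Fin m) m → Bool
isPermᵇ ρ = isYes (surjective? ρ) ∧ isYes (injective? ρ)

reorder : ∀ {m} → Vec (Fin m) m → Subset m → Subset m
reorder ρ v = Vec.map (lookup v) ρ

-- Mapping `l` into `r` suffices: a permutation is injective on words and `r` is no longer than `l`,
-- so the map is onto. What `arrangements` proposes is checked afresh, so soundness does not rest on
-- that search.
isoᵇ : ∀ {m} → List (Subset m) → List (Subset m) → Bool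
isoᵇ {m} l r = distinctᵇ l ∧ (length r ≤ᵇ length l) ∧
  any (λ ρ → isPermᵇ ρ ∧ all (λ v → reorder ρ v ∈ᵇ r) l) (arrangements m (map (_, r) l) (allFin m))

toPermutation : ∀ {m} (ρ : Vec (Fin m) m) → T (isPermᵇ ρ) → ∃[ π ] (∀ v → permute π v ≡ reorder ρ v)
toPermutation ρ t = permutation (lookup ρ) (proj₁ ∘ inv) (proj₂ ∘ inv) (λ j → inj _ _ (proj₂ (inv (lookup ρ j)))) ,
  λ v → trans (tabulate-∘ (lookup v) (lookup ρ)) (cong (Vec.map (lookup v)) (tabulate∘lookup ρ))
  where
  inv = toWitness {a? = surjective? ρ} (proj₁ (∧⁻ t))
  inj = toWitness {a? = injective? ρ} (proj₂ (∧⁻ {isYes (surjective? ρ)} t))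

permute-injective : ∀ {m} (π : Permutation′ m) {u v : Subset m} → permute π u ≡ permute π v → u ≡ v
permute-injective π {u} {v} eq = begin
  u                   ≡⟨ tabulate∘lookup u ⟨
  tabulate (lookup u) ≡⟨ tabulate-cong same ⟩
  tabulate (lookup v) ≡⟨ tabulate∘lookup v ⟩
  v                   ∎
  where
  open ≡-Reasoning
  at : ∀ w i → lookup (permute π w) (π ⟨$⟩ˡ i) ≡ lookup w i
  at w i = trans (lookup∘tabulate _ (π ⟨$⟩ˡ i)) (cong (lookup w) (Perm.inverseʳ π))
  same : ∀ i → lookup u i ≡ lookup v i
  same i = trans (sym (at u i)) (trans (cong (λ w → lookup w (π ⟨$⟩ˡ i)) eq) (at v i))

isoᵇ⇒≅ : ∀ {m} (B C : Code m) l → T (isoᵇ l (vectors C)) →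
         (∀ {v} → v ∈ l → v ∈ᶜ B) → (∀ {v} → v ∈ᶜ B → v ∈ l) → B ≅ C
isoᵇ⇒≅ {m} B C l t l⊆B B⊆l = π , λ v → mk⇔ (to ∘ B⊆l) (from v)
  where
  r = vectors C
  maps : Vec (Fin m) m → Bool
  maps ρ = isPermᵇ ρ ∧ all (λ v → reorder ρ v ∈ᵇ r) l
  t₁ = ∧⁻ {distinctᵇ l} t
  t₂ = ∧⁻ {length r ≤ᵇ length l} (proj₂ t₁)
  found = Any.satisfied (Any.any⁻ maps (arrangements m (map (_, r) l) (allFin m)) (proj₂ t₂))
  ρ = proj₁ found
  perm = ∧⁻ {isPermᵇ ρ} (proj₂ found)
  π = proj₁ (toPermutation ρ (proj₁ perm))
  eq = proj₂ (toPermutation ρ (proj₁ perm))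
  to : ∀ {v} → v ∈ l → permute π v ∈ r
  to {v} v∈ = subst (_∈ r) (sym (eq v)) (∈ᵇ⇒∈ (reorder ρ v) r (All.lookup (All.all⁺ _ l (proj₂ perm)) v∈))
  image : ∀ {w} → w ∈ map (permute π) l → w ∈ r
  image w∈ with ∈-map⁻ (permute π) w∈
  ... | v , v∈ , refl = to v∈
  preimage : ∀ {v} → ∃[ w ] (w ∈ l × permute π v ≡ permute π w) → v ∈ᶜ B
  preimage (w , w∈ , pv≡pw) = l⊆B (subst (_∈ l) (sym (permute-injective π pv≡pw)) w∈)
  from : ∀ v → permute π v ∈ r → v ∈ᶜ B
  from v pv∈ = preimage (∈-map⁻ (permute π) (saturated {xs = map (permute π) l} {ys = r}
    (Unique.map⁺ (permute-injective π) (distinctᵇ⇒Unique l (proj₁ t₁))) image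
    (subst (length r ≤_) (sym (length-map (permute π) l)) (≤ᵇ⇒≤ _ _ (proj₁ t₂))) pv∈))

-- Exhaustive search

module Search {n : ℕ} (hits : Subset n → Subset n → Bool) (ok : Subset n → List (Subset n) → Bool)
              (candidates : List (Subset n)) where

  search : List (Subset n) → List (Subset n) → List (List (Subset n))
  search []       chosen = chosen ∷ []
  search (t ∷ ts) chosen =
    if any (hits t) chosen then search ts chosen
    else concatMap (λ c → if ok c chosen then search ts (c ∷ chosen) else []) (filterᵇ (hits t) candidates)

  -- `B` guides the search: at a target not yet hit, take the branch of a member of `B` hitting it.
  -- That member is new because no chosen word hits the target, so the list stays duplicate-free and
  -- passes `ok`.
  search-complete : ∀ (B : Subset n → Set) ts →
    (∀ {t} → t ∈ ts → ∃[ c ] (c ∈ candidates × T (hits t c) × B c)) →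
    (∀ c {chosen} → Unique (c ∷ chosen) → All B (c ∷ chosen) → T (ok c chosen)) →
    ∀ {chosen} → Unique chosen → All B chosen →
    ∃[ l ] (l ∈ search ts chosen × Unique l × All B l)
  search-complete B []       hit ok-B u b = _ , here refl , u , b
  search-complete B (t ∷ ts) hit ok-B {chosen} u b with any (hits t) chosen in eq
  ... | true  = search-complete B ts (hit ∘ there) ok-B u b
  ... | false with hit (here refl)
  ...   | c , c∈ , t-c , Bc =
    let l , l∈ , rest = search-complete B ts (hit ∘ there) ok-B u′ (Bc ∷ b)
    in l , ∈-concatMap⁺ next (Any.map (λ where refl → step′ l∈) (∈-filter⁺ (T? ∘ hits t) c∈ t-c)) , rest
    where
    next : Subset n → List (List (Subset n))
    next c = if ok c chosen then search ts (c ∷ chosen) else []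
    u′ : Unique (c ∷ chosen)
    u′ = All.tabulate (λ x∈ c≡x → subst T eq
           (Any.any⁺ (hits t) (Any.map (λ where refl → subst (T ∘ hits t) c≡x t-c) x∈))) ∷ u
    step′ : ∀ {l} → l ∈ search ts (c ∷ chosen) → l ∈ next c
    step′ {l} l∈ with ok c chosen | ok-B c u′ (Bc ∷ b)
    ... | true | _ = l∈

-- Unions of covering designs

even : Parity → Bool
even 0ℙ = true
even 1ℙ = false

parity-suc-odd : ∀ k → parity k ≡ 1ℙ → parity (suc k) ≡ 0ℙ
parity-suc-odd 1             _  = refl
parity-suc-odd (suc (suc k)) eq = parity-suc-odd k eq

parity-suc-even : ∀ k → parity k ≡ 0ℙ → parity (suc k) ≡ 1ℙ
parity-suc-even 0             _  = refl
parity-suc-even (suc (suc k)) eq = parity-suc-even k eq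

parity-pred : ∀ k → parity (suc k) ≡ 0ℙ → parity k ≡ 1ℙ
parity-pred 1             _  = refl
parity-pred (suc (suc k)) eq = parity-pred k eq

∣∷ʳtrue∣ : ∀ {n} (v : Subset n) → ∣ v ∷ʳ true ∣ ≡ suc ∣ v ∣
∣∷ʳtrue∣ []          = refl
∣∷ʳtrue∣ (true ∷ v)  = cong suc (∣∷ʳtrue∣ v)
∣∷ʳtrue∣ (false ∷ v) = ∣∷ʳtrue∣ v

∣∷ʳfalse∣ : ∀ {n} (v : Subset n) → ∣ v ∷ʳ false ∣ ≡ ∣ v ∣
∣∷ʳfalse∣ []          = refl
∣∷ʳfalse∣ (true ∷ v)  = cong suc (∣∷ʳfalse∣ v)
∣∷ʳfalse∣ (false ∷ v) = ∣∷ʳfalse∣ v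

∷ʳtrue-⊑ : ∀ {n} (v u : Subset n) x → T (v ⊑ u) → T (v ∷ʳ x ⊑ u ∷ʳ true)
∷ʳtrue-⊑ []          []         true  _ = tt
∷ʳtrue-⊑ []          []         false _ = tt
∷ʳtrue-⊑ (true ∷ v)  (true ∷ u) x     p = ∷ʳtrue-⊑ v u x p
∷ʳtrue-⊑ (false ∷ v) (_ ∷ u)    x     p = ∷ʳtrue-⊑ v u x p

∷ʳfalse-⊑ : ∀ {n} (v u : Subset n) → T (v ⊑ u) → T (v ∷ʳ false ⊑ u ∷ʳ false)
∷ʳfalse-⊑ []          []         _ = tt
∷ʳfalse-⊑ (true ∷ v)  (true ∷ u) p = ∷ʳfalse-⊑ v u p
∷ʳfalse-⊑ (false ∷ v) (_ ∷ u)    p = ∷ʳfalse-⊑ v u p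

extendVector-even : ∀ {n} (v : Subset n) → parity (coweight (extendVector v)) ≡ 0ℙ
extendVector-even {n} v with parity (coweight v) in eq
... | 0ℙ rewrite ∣∷ʳtrue∣ v = eq
... | 1ℙ rewrite ∣∷ʳfalse∣ v | +-∸-assoc 1 (∣p∣≤n v) = parity-suc-odd (n ∸ ∣ v ∣) eq

-- A set to be covered ends in 1 or 0. In the first case the rest has odd co-weight, and bandedness
-- gives a word above it, which is extended by 1. In the second the rest `v` has even co-weight:
-- either `v` is in `D` and is extended by 1, or the word covering it has odd co-weight and is
-- extended by 0.
extend-unionOfDesigns : ∀ {n} (D : Code n) → IsAsymmetricCovering D → IsBanded D →
                        IsUnionOfCoveringDesigns (extend D)
extend-unionOfDesigns {n} D covering banded = all-even , λ k k<m ev →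
  (λ b b∈ → proj₂ (∈-filter⁻ (λ v → ∣ v ∣ ≟ suc k) {xs = vectors (extend D)} b∈)) ,
  λ T′ eq → block k (≤-pred k<m) ev T′ eq
  where
  all-even : ∀ u → u ∈ᶜ extend D → parity (coweight u) ≡ 0ℙ
  all-even u u∈ with ∈-map⁻ extendVector u∈
  ... | v , _ , refl = extendVector-even v
  in-layer : ∀ {k u} b → u ∈ᶜ D → bitFor (parity (coweight u)) ≡ b → ∣ u ∷ʳ b ∣ ≡ suc k →
             (u ∷ʳ b) ∈ᶜ layer (suc k) (extend D)
  in-layer {k} {u} b u∈ refl eq = ∈-filter⁺ (λ v → ∣ v ∣ ≟ suc k) (∈-map⁺ extendVector u∈) eq
  block : ∀ k → k ≤ n → parity (n ∸ k) ≡ 0ℙ → ∀ (t : Subset (suc n)) → ∣ t ∣ ≡ k →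
          ∃[ b ] (b ∈ᶜ layer (suc k) (extend D) × t ⊆ b)
  block k k≤n ev t eq with Vec.initLast t
  block k k≤n ev .(v ∷ʳ true) eq | v , true , refl
    with trans (sym (∣∷ʳtrue∣ v)) eq
  ... | refl
    with banded v (trans (cong parity (trans (cong (_∸ ∣ v ∣) (sym (m∸n+n≡m k≤n)))
           (trans (+-∸-assoc (n ∸ suc ∣ v ∣) (n≤1+n ∣ v ∣))
             (trans (cong (n ∸ suc ∣ v ∣ +_) (m+n∸n≡m 1 ∣ v ∣)) (+-comm _ 1)))))
           (parity-suc-even (n ∸ suc ∣ v ∣) ev))
  ... | u , u∈ , v⊆u , ∣u∣ =
    u ∷ʳ true ,
    in-layer true u∈ (cong bitFor (trans (cong (λ w → parity (n ∸ w)) (trans ∣u∣ (+-comm ∣ v ∣ 1))) ev))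
      (trans (∣∷ʳtrue∣ u) (cong suc (trans ∣u∣ (+-comm ∣ v ∣ 1)))) ,
    ⊑⇒⊆ _ _ (∷ʳtrue-⊑ v u true (⊆⇒⊑ v u v⊆u))
  block k k≤n ev .(v ∷ʳ false) eq | v , false , refl
    with trans (sym (∣∷ʳfalse∣ v)) eq | covering v
  ... | refl | inj₁ v∈ =
    v ∷ʳ true , in-layer true v∈ (cong bitFor ev) (∣∷ʳtrue∣ v) , ⊑⇒⊆ _ _ (∷ʳtrue-⊑ v v false (⊑-refl v))
  ... | refl | inj₂ (u , u∈ , v⊆u , ∣u∣) =
    u ∷ʳ false ,
    in-layer false u∈ (cong bitFor (parity-pred (n ∸ ∣ u ∣) (trans (cong parity
      (trans (sym (+-∸-assoc 1 (∣p∣≤n u))) (cong (suc n ∸_) eq′))) ev)))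
      (trans (∣∷ʳfalse∣ u) eq′) ,
    ⊑⇒⊆ _ _ (∷ʳfalse-⊑ v u (⊆⇒⊑ v u v⊆u))
    where
    eq′ : ∣ u ∣ ≡ suc ∣ v ∣
    eq′ = trans ∣u∣ (+-comm ∣ v ∣ 1)

-- the least significant bit is the first coordinate
bits : ∀ n → ℕ → Subset n
bits zero    k = []
bits (suc n) k = (k % 2 ≡ᵇ 1) ∷ bits n (k / 2)

code : ∀ n (ks : List ℕ) → {T (distinctᵇ (map (bits n) ks))} → Code n
code n ks {t} = mkCode (map (bits n) ks) (distinctᵇ⇒Unique _ t)

above : ∀ {n} → Subset n → Subset n → Bool
above v u = (v ⊑ u) ∧ (∣ u ∣ ≡ᵇ suc ∣ v ∣)

above⇒CoveredBy : ∀ {n} (D : Code n) v → T (any (above v) (vectors D)) → CoveredBy D v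
above⇒CoveredBy D v t with find (Any.any⁻ (above v) (vectors D) t)
... | u , u∈ , ab = u , u∈ , ⊑⇒⊆ v u (proj₁ (∧⁻ ab)) , trans (≡ᵇ⇒≡ _ _ (proj₂ (∧⁻ {v ⊑ u} ab))) (+-comm 1 ∣ v ∣)

coveringᵇ : ∀ {n} → List (Subset n) → Bool
coveringᵇ l = allSubsets λ v → (v ∈ᵇ l) ∨ any (above v) l

coveringᵇ⇒covering : ∀ {n} (D : Code n) → T (coveringᵇ (vectors D)) → IsAsymmetricCovering D
coveringᵇ⇒covering D t v
  with Equivalence.to T-∨ (allSubsets⁻ (λ v → (v ∈ᵇ vectors D) ∨ any (above v) (vectors D)) t v)
... | inj₁ p = inj₁ (∈ᵇ⇒∈ v (vectors D) p)
... | inj₂ p = inj₂ (above⇒CoveredBy D v p)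

any-⊆ : ∀ {n} (p : Subset n → Bool) {xs ys} → (∀ {x} → x ∈ xs → x ∈ ys) → T (any p xs) → T (any p ys)
any-⊆ p {xs} xs⊆ys t with find (Any.any⁻ p xs t)
... | x , x∈ , px = Any.any⁺ p (Any.map (λ where refl → px) (xs⊆ys x∈))

-- The budget `size rep` stands in for minimality, as it is what the search and the cuts can use;
-- `minimal` then shows that `rep` attains the minimum.
record Classified {n} (rep : Code n) : Set where
  field
    covering : IsAsymmetricCovering rep
    minimal  : ∀ (D : Code n) → IsAsymmetricCovering D → size D ≤ size rep → size rep ≤ size D
    banded   : ∀ (D : Code n) → IsAsymmetricCovering D → size D ≤ size rep → IsBanded D
    unique   : ∀ (D : Code n) → IsAsymmetricCovering D → size D ≤ size rep → extend D ≅ᵁ extend rep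

smallest : ∀ {n} (rep : Code n) → IsAsymmetricCovering rep →
           (∀ (D : Code n) → IsAsymmetricCovering D → size D ≤ size rep → size rep ≤ size D) → IsMinimum rep
smallest rep cov min = cov , λ E E-cov → [ min E E-cov , id ]′ (≤-total (size E) (size rep))

classify : ∀ {n} {rep : Code n} → Classified rep →
  ((D : Code n) → IsMinimum D → IsBanded D × IsUnionOfCoveringDesigns (extend D)) ×
  ClassCount _≅ᵁ_ (IsMinimumUnion {n}) 1
classify {n} {rep} c =
  (λ D min → let b = banded D (proj₁ min) (proj₂ min rep covering)
             in b , extend-unionOfDesigns D (proj₁ min) b) ,
  record
    { rep          = λ _ → extend rep
    ; rep-P        = λ _ → rep , smallest rep covering minimal , refl
    ; inequivalent = λ where Fin.zero Fin.zero _ → refl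
    ; complete     = λ where U (D , min , refl) → Fin.zero , unique D (proj₁ min) (proj₂ min rep covering)
    }
  where open Classified c

weightIs : ∀ {m} → ℕ → List (Subset m) → List (Subset m)
weightIs k = filter (λ v → ∣ v ∣ ≟ k)

layer-mono : ∀ {n} k (xs ys : List (Subset n)) → (∀ {u} → u ∈ xs → u ∈ ys) → ∀ {v} →
             v ∈ weightIs k (map extendVector xs) → v ∈ weightIs k (map extendVector ys)
layer-mono k xs ys xs⊆ys v∈ with ∈-filter⁻ (λ v → ∣ v ∣ ≟ k) {xs = map extendVector xs} v∈
... | v∈′ , eq with ∈-map⁻ extendVector v∈′
...   | w , w∈ , refl = ∈-filter⁺ (λ v → ∣ v ∣ ≟ k) (∈-map⁺ extendVector (xs⊆ys w∈)) eq

odd : ∀ {n} → Subset n → Bool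
odd v = not (even (parity (coweight v)))

odd⁺ : ∀ {n} (v : Subset n) → parity (coweight v) ≡ 1ℙ → T (odd v)
odd⁺ v eq rewrite eq = tt

bandedᵇ : ∀ {n} → List (Subset n) → Bool
bandedᵇ l = allSubsets λ v → not (odd v) ∨ any (above v) l

bandedᵇ⇒banded : ∀ {n} (D : Code n) {l} → (∀ {u} → u ∈ l → u ∈ᶜ D) → T (bandedᵇ l) → IsBanded D
bandedᵇ⇒banded D {l} l⊆D t v eq
  with odd v | odd⁺ v eq | allSubsets⁻ (λ v → not (odd v) ∨ any (above v) l) t v
... | true | _ | p = above⇒CoveredBy D v (any-⊆ (above v) l⊆D p)

layer-isoᵇ : ∀ {n} → Code n → List (Subset n) → ℕ → Bool
layer-isoᵇ rep l k = isoᵇ (weightIs k (map extendVector l)) (vectors (layer k (extend rep)))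

-- `_≅ᵁ_` speaks of every weight, whereas the evaluated checks stop at the length of the words.
empty-layer : ∀ {m} k (B : Code m) → k > m → ∀ {v} → v ∉ vectors (layer k B)
empty-layer k B k>m {v} v∈ with proj₂ (∈-filter⁻ (λ v → ∣ v ∣ ≟ k) {xs = vectors B} v∈)
... | refl = contradiction (∣p∣≤n v) (<⇒≱ k>m)

≅-empty : ∀ {m} (B C : Code m) → (∀ {v} → v ∉ vectors B) → (∀ {v} → v ∉ vectors C) → B ≅ C
≅-empty B C B∅ C∅ = Perm.id , λ v → mk⇔ (λ v∈ → contradiction v∈ B∅) (λ v∈ → contradiction v∈ C∅)

-- Covering all words within a budget

module Small {n : ℕ} (N : ℕ) where

  near : Subset n → Subset n → Bool
  near t c = (t ⊑ c) ∧ (∣ c ∣ ∸ ∣ t ∣ ≤ᵇ 1)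

  words : List (Subset n)
  -- Heaviest first: a word of weight w has only n - w + 1 candidates near it.
  words = concatMap (subsets n) (downFrom (suc n))

  ∈-words : ∀ v → v ∈ words
  ∈-words v = ∈-concatMap⁺ (subsets n) (Any.map (λ where refl → ∈-subsets⁺ v) (∈-downFrom⁺ (s≤s (∣p∣≤n v))))

  open Search near (λ c chosen → length chosen <ᵇ N) words

  coverings : List (List (Subset n))
  coverings = search words []

  -- The length test never prunes inside `D`, whose duplicate-free lists have at most `N` words. The
  -- list found lies in `D` and has at least `N` words, so it exhausts `D`.
  coverings-complete : T (all (λ l → N ≤ᵇ length l) coverings) → ∀ D → IsAsymmetricCovering D → size D ≤ N →
    ∃[ l ] (l ∈ coverings × (∀ {u} → u ∈ l → u ∈ᶜ D) × (∀ {u} → u ∈ᶜ D → u ∈ l) × N ≤ size D)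
  coverings-complete large D cov small =
    let l , l∈ , u , l⊆D = search-complete (_∈ᶜ D) words hit
                             (λ c u b → <⇒<ᵇ (≤-trans (unique-length u (All.lookup b)) small)) [] []
        N≤l = ≤ᵇ⇒≤ _ _ (all-∈ (λ l → N ≤ᵇ length l) large l∈)
    in l , l∈ , All.lookup l⊆D , saturated u (All.lookup l⊆D) (≤-trans small N≤l) ,
       ≤-trans N≤l (unique-length u (All.lookup l⊆D))
    where
    hit : ∀ {t} → t ∈ words → ∃[ c ] (c ∈ words × T (near t c) × c ∈ᶜ D)
    hit {t} _ with cov t
    ... | inj₁ t∈ = t , ∈-words t , Equivalence.from T-∧ (⊑-refl t ,
      subst (λ d → T (d ≤ᵇ 1)) (sym (n∸n≡0 ∣ t ∣)) tt) , t∈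
    ... | inj₂ (u , u∈ , t⊆u , eq) = u , ∈-words u , Equivalence.from T-∧ (⊆⇒⊑ t u t⊆u ,
      subst (λ d → T (d ≤ᵇ 1)) (sym (trans (cong (_∸ ∣ t ∣) eq) (m+n∸m≡n ∣ t ∣ 1))) tt) , u∈

  classified : ∀ (rep : Code n) → N ≡ size rep → coveringᵇ (vectors rep) ≡ true →
    all (λ l → N ≤ᵇ length l) coverings ≡ true →
    all (λ l → bandedᵇ l ∧ all (layer-isoᵇ rep l) (upTo (2 + n))) coverings ≡ true → Classified rep
  classified rep refl cov large ok = record
    { covering = coveringᵇ⇒covering rep (T≡ cov)
    ; minimal  = λ D D-cov small → let _ , _ , _ , _ , N≤ = coverings-complete (T≡ large) D D-cov small in N≤
    ; banded   = λ D D-cov small →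
        let l , l∈ , l⊆D , _ = coverings-complete (T≡ large) D D-cov small
        in bandedᵇ⇒banded D l⊆D (proj₁ (∧⁻ (all-∈ check (T≡ ok) l∈)))
    ; unique   = uniq
    }
    where
    check : List (Subset n) → Bool
    check l = bandedᵇ l ∧ all (layer-isoᵇ rep l) (upTo (2 + n))
    uniq : ∀ D → IsAsymmetricCovering D → size D ≤ size rep → extend D ≅ᵁ extend rep
    uniq D D-cov small k with k <? 2 + n
    ... | no k≮ = ≅-empty (layer k (extend D)) (layer k (extend rep))
                    (empty-layer k (extend D) (≮⇒≥ k≮)) (empty-layer k (extend rep) (≮⇒≥ k≮))
    ... | yes k< with coverings-complete (T≡ large) D D-cov small
    ...   | l , l∈ , l⊆D , D⊆l , _ =
      isoᵇ⇒≅ (layer k (extend D)) (layer k (extend rep)) (weightIs k (map extendVector l))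
        (all-∈ (layer-isoᵇ rep l) (proj₂ (∧⁻ {bandedᵇ l} (all-∈ check (T≡ ok) l∈))) (∈-upTo⁺ k<))
        (layer-mono k l (vectors D) l⊆D) (layer-mono k (vectors D) l D⊆l)

-- Lengths above the reach of the search

-- If v is not covered, the inequalities of its upper neighbours halve to a bound
-- aboveBound on the words two levels above v.  The rest is a certificate that
-- the size then exceeds the minimum.
record Low : Set where
  constructor rule
  field
    aboveBound    : ℕ
    divisor       : ℕ
    aboveMultiple : ℕ
    topMultiple   : ℕ
    premises      : List Entry

-- Each valid cut reaches its bound; if the sum does not exceed the sum of the bounds, no single cut
-- has slack.
tight : ∀ {n} (xs : List (Subset n)) ds → ValidAll xs ds → total (combine ds) xs ≤ combinedBound ds →
        ∀ {c} → (1 , c) ∈ ds → total (coef c) xs ≤ Cut.bound c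
tight xs ((k , d) ∷ ds) (v ∷ vs) le c∈ = go c∈
  where
  open ≤-Reasoning
  split : k * total (coef d) xs + total (combine ds) xs ≤ k * Cut.bound d + combinedBound ds
  split = begin
    k * total (coef d) xs + total (combine ds) xs         ≡⟨ cong (_+ total (combine ds) xs) (total-* k (coef d) xs) ⟨
    total (λ u → k * coef d u) xs + total (combine ds) xs ≡⟨ total-+ (λ u → k * coef d u) (combine ds) xs ⟨
    total (combine ((k , d) ∷ ds)) xs                     ≤⟨ le ⟩
    k * Cut.bound d + combinedBound ds                    ∎
  go : ∀ {c} → (1 , c) ∈ (k , d) ∷ ds → total (coef c) xs ≤ Cut.bound c
  go {c} (here refl) = subst₂ _≤_ (*-identityˡ (total (coef c) xs)) (*-identityˡ (Cut.bound c))
    (+-cancelʳ-≤ (total (combine ds) xs) _ _ (≤-trans split (+-monoʳ-≤ (1 * Cut.bound c) (combine-valid xs vs))))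
  go (there c∈′) = tight xs ds vs (+-cancelˡ-≤ (k * total (coef d) xs) _ _
    (≤-trans split (+-monoˡ-≤ (combinedBound ds) (*-monoʳ-≤ k v)))) c∈′

-- The profile of all weights but k. A lower bound for it turns a bound on the size into an upper
-- bound on the layer k.
except : ℕ → ℕ → List ℕ
except m k = List.replicate k 1 ++ 0 ∷ List.replicate (m ∸ k) 1

entry-except : ∀ k j i → entry (List.replicate k 1 ++ 0 ∷ List.replicate j 1) i ≤ 1
entry-except zero    j zero    = z≤n
entry-except zero    j (suc i) = entry-replicate j i
entry-except (suc k) j zero    = ≤-refl
entry-except (suc k) j (suc i) = entry-except k j i

entry-except-self : ∀ k j → entry (List.replicate k 1 ++ 0 ∷ List.replicate j 1) k ≡ 0
entry-except-self zero    j = refl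
entry-except-self (suc k) j = entry-except-self k j

weights-∣∣ : ∀ {n} g b (u : Subset n) → coef (weights g b) u ≡ entry g ∣ u ∣
weights-∣∣ {n} g b u = coef-⊒ ⊥ u g b ∣ u ∣ (⊆⇒⊑ ⊥ u (⊆-min u))
  (sym (trans (cong (∣ u ∣ +_) (∣⊥∣≡0 n)) (+-identityʳ ∣ u ∣)))

∉-short : ∀ {A : Set} (xs : List A) → length xs ≤ 0 → ∀ {x} → x ∉ xs
∉-short [] _ ()

filter-total : ∀ {A : Set} {P : A → Set} (P? : ∀ x → Dec (P x)) (f : A → ℕ) →
               (∀ {x} → P x → f x ≡ 0) → (∀ x → f x ≤ 1) →
               ∀ xs → length (filter P? xs) + total f xs ≤ length xs
filter-total P? f f≡0 f≤1 []       = z≤n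
filter-total P? f f≡0 f≤1 (x ∷ xs) with P? x
... | yes Px rewrite f≡0 Px = s≤s (filter-total P? f f≡0 f≤1 xs)
... | no _ = begin
  length (filter P? xs) + (f x + total f xs)   ≡⟨ solve 3 (λ a b c → a :+ (b :+ c) := b :+ (a :+ c)) refl
                                                     (length (filter P? xs)) (f x) (total f xs) ⟩
  f x + (length (filter P? xs) + total f xs)   ≤⟨ +-mono-≤ (f≤1 x) (filter-total P? f f≡0 f≤1 xs) ⟩
  suc (length xs)                              ∎
  where
  open ≤-Reasoning
  open +-*-Solver

weightIs-size : ∀ {m} (xs : List (Subset m)) k b →
                length (weightIs k xs) + total (coef (weights (except m k) b)) xs ≤ length xs
weightIs-size {m} xs k b = filter-total (λ v → ∣ v ∣ ≟ k) (coef (weights (except m k) b))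
  (λ {u} eq → trans (weights-∣∣ (except m k) b u)
    (trans (cong (entry (except m k)) eq) (entry-except-self k (m ∸ k))))
  (λ u → subst (_≤ 1) (sym (weights-∣∣ (except m k) b u)) (entry-except k (m ∸ k) ∣ u ∣)) xs

module Large {n : ℕ} (N : ℕ) (script : List Step) (tree : Tree n) (low : ℕ → Maybe Low)
             (counts : List ℕ) (rep : Code n) where

  facts : List Family
  facts = after (covers n) script

  count : ℕ → ℕ
  count = entry counts

  -- The weights n - 2, n - 1 and n of the covering make up the layers n - 1 and n + 1 of the
  -- extended code.
  topCut : Cut n
  topCut = weights (List.replicate (n ∸ 2) 0 ++ 1 ∷ 1 ∷ 1 ∷ []) (count (suc n) + count (n ∸ 1))

  layerCut : ℕ → Cut (suc n)
  layerCut k = weights (List.replicate k 0 ++ 1 ∷ []) (count k)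

  layerOK : ℕ → List (Subset (suc n)) → Bool
  layerOK k l = (count k ≤ᵇ length l) ∧ isoᵇ l (vectors (layer k (extend rep)))

  topOK : List (Subset n) → Bool
  topOK l = follows [] 1 (fill 1 l []) topCut ∧
            follows [] 1 (fill 1 (weightIs (n ∸ 1) (map extendVector l)) []) (layerCut (n ∸ 1)) ∧
            layerOK (n ∸ 1) (weightIs (n ∸ 1) (map extendVector l))

  aboveList : Subset n → List (Subset n)
  aboveList v = filterᵇ (v ⊑_) (subsets n (suc ∣ v ∣))

  aboveEntries : Subset n → List Entry
  aboveEntries v = (1 , cover (suc ∣ v ∣) , ∣ v ∣ ∷ []) ∷ []

  lowOK : Subset n → Low → Bool
  lowOK v (rule b k i j es) =
    (known facts (aboveEntries v) ∧ known facts es) ∧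
    -- A word two levels above `v` contains exactly two upper neighbours of `v`. Their number is the
    -- co-weight of `v`, which is odd, so the halving gains by rounding up.
    (follows (aboveList v) 2 (concatMap (instances (v ∷ [])) (aboveEntries v)) (cut v (0 ∷ 0 ∷ 1 ∷ []) b) ∧
     follows (aboveList v) k ((i , cut v (0 ∷ 0 ∷ 1 ∷ []) b) ∷ (j , topCut) ∷ concatMap (instances (v ∷ [])) es)
       (sizeCut n (suc N)))

  bandedAt : List (List (Subset n)) → Subset n → Bool
  bandedAt tops v with odd v | low ∣ v ∣
  ... | false | _       = true
  -- The co-weights 1 and 3: the words of weight n and n - 2 forced by the tree already cover these.
  ... | true  | nothing = all (any (above v)) tops
  ... | true  | just p  = lowOK v p

  hits : Subset (suc n) → Subset (suc n) → Bool
  hits t c = t ⊑ c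

  disjoint : List (Subset (suc n)) → Subset (suc n) → List (Subset (suc n)) → Bool
  disjoint ts c chosen = all (λ t → not (t ⊑ c) ∨ not (any (t ⊑_) chosen)) ts

  designCuts : ℕ → Combination (suc n)
  designCuts t = map (λ R → 1 , cut R (0 ∷ 1 ∷ []) 1) (subsets (suc n) t)

  designs : ℕ → List (List (Subset (suc n)))
  designs t = Search.search hits (disjoint (subsets (suc n) t)) (subsets (suc n) (suc t)) (subsets (suc n) t) []

  -- A block contains t + 1 sets of size t, so the `designCuts` divided by t + 1 bound the layer
  -- from below. The next inequality leaves `count` blocks no room for overlap: a layer of that size
  -- is a Steiner system, and `designs` searches for these.
  steinerOK : ℕ → Bool
  steinerOK zero    = false
  steinerOK (suc t) =
    (even (parity (n ∸ t)) ∧ follows [] (suc t) (designCuts t) (layerCut (suc t))) ∧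
    (((suc t * count (suc t) ≤ᵇ combinedBound (designCuts t)) ∧
      allSubsets (λ u → (combine (designCuts t) u ≤ᵇ suc t) ∨ not (∣ u ∣ ≡ᵇ suc t))) ∧
     all (layerOK (suc t)) (designs t))

  designOK : ℕ → Bool
  designOK k = (k ≡ᵇ n ∸ 1) ∨ ((count k ≡ᵇ 0) ∨ steinerOK k)

  restOK : ℕ → Bool
  restOK k = follows [] 1 (map (λ j → 1 , layerCut j) (filterᵇ (λ j → not (j ≡ᵇ k)) (upTo (2 + n))))
               (weights (except (suc n) k) (N ∸ count k)) ∧ (count k ≤ᵇ N)

  module _ (scriptOK : correct n (covers n) script ≡ true)
           (treeOK   : closes facts (suc N) [] [] tree ≡ true)
           (topsOK   : all topOK (accepted [] tree) ≡ true)
           (bandedOK : allSubsets (bandedAt (accepted [] tree)) ≡ true)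
           (designsOK : all designOK (upTo (2 + n)) ≡ true)
           (restsOK  : all restOK (upTo (2 + n)) ≡ true)
           (sizeOK   : follows [] 1 (map (λ j → 1 , layerCut j) (upTo (2 + n))) (sizeCut (suc n) N) ≡ true)
           where

    module Covering (D : Code n) (cov : IsAsymmetricCovering D) (small : size D ≤ N) where

      facts-hold : All (Holds (vectors D)) facts
      facts-hold = after-holds (vectors D) script (T≡ scriptOK) (covers-hold D cov)

      top : ∃[ l ] (l ∈ accepted [] tree × (∀ {u} → u ∈ l → u ∈ᶜ D))
      top = closes-sound tree (T≡ treeOK) facts-hold (s≤s small) (λ ()) (λ ())

      l = proj₁ top
      l⊆D = proj₂ (proj₂ top)
      l-OK = ∧⁻ {follows [] 1 (fill 1 l []) topCut} (all-∈ topOK (T≡ topsOK) (proj₁ (proj₂ top)))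

      topCut-valid : Valid (vectors D) topCut
      topCut-valid = follows-valid (vectors D) [] {1} {fill 1 l []} {topCut} (proj₁ l-OK) (λ _ ())
                       (fill-valid {k = 1} {ds = []} l⊆D [])

      banded : IsBanded D
      banded v eq with any (above v) (vectors D) in e
      ... | true  = above⇒CoveredBy D v (T≡ e)
      ... | false with odd v | odd⁺ v eq | low ∣ v ∣ | allSubsets⁻ (bandedAt (accepted [] tree)) (T≡ bandedOK) v
      ...   | true | _ | nothing | ok =
              contradiction (any-⊆ (above v) l⊆D (all-∈ (any (above v)) ok (proj₁ (proj₂ top)))) (subst T e)
      ...   | true | _ | just (rule b k i j es) | ok =
              contradiction small (<⇒≱ (sizeCut-valid (vectors D) {suc N}
                (follows-valid (vectors D) (aboveList v) {k} {ds}
                {sizeCut n (suc N)} (proj₂ rest) avoid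
                (above-valid ∷ topCut-valid ∷ instances-valid (vectors D) (v ∷ []) es facts-hold (proj₂ knowns)))))
        where
        X  = cut v (0 ∷ 0 ∷ 1 ∷ []) b
        ds₁ = concatMap (instances (v ∷ [])) (aboveEntries v)
        ds = (i , X) ∷ (j , topCut) ∷ concatMap (instances (v ∷ [])) es
        knowns = ∧⁻ {known facts (aboveEntries v)} (proj₁ (∧⁻ ok))
        rest   = ∧⁻ {follows (aboveList v) 2 ds₁ X} (proj₂ (∧⁻ {known facts (aboveEntries v) ∧ known facts es} ok))
        avoid : ∀ {u} → u ∈ vectors D → u ∉ aboveList v
        is-above : ∀ {u} → u ∈ aboveList v → T (above v u)
        is-above {u} u∈a =
          let u∈s , v⊑u = ∈-filter⁻ (T? ∘ (v ⊑_)) {xs = subsets n (suc ∣ v ∣)} u∈a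
          in Equivalence.from T-∧ (v⊑u , ≡⇒≡ᵇ ∣ u ∣ (suc ∣ v ∣) (∈-subsets⁻ n (suc ∣ v ∣) u∈s))
        avoid {u} u∈ u∈a = subst T e (Any.any⁺ (above v) (Any.map (λ where refl → is-above u∈a) u∈))
        above-valid : Valid (vectors D) X
        above-valid = follows-valid (vectors D) (aboveList v) {2} {ds₁} {X} (proj₁ rest) avoid
                        (instances-valid (vectors D) (v ∷ []) (aboveEntries v) facts-hold (proj₁ knowns))

      U : Code (suc n)
      U = extend D

      union : IsUnionOfCoveringDesigns U
      union = extend-unionOfDesigns D cov banded

      block : ∀ t → t ≤ n → parity (n ∸ t) ≡ 0ℙ → ∀ (T′ : Subset (suc n)) → ∣ T′ ∣ ≡ t →
              ∃[ b ] (b ∈ᶜ layer (suc t) U × T (T′ ⊑ b) × ∣ b ∣ ≡ suc t)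
      block t t≤n ev T′ eq = let b , b∈ , T⊆b = proj₂ (proj₂ union t (s≤s t≤n) ev) T′ eq
                             in b , b∈ , ⊆⇒⊑ T′ b T⊆b , proj₁ (proj₂ union t (s≤s t≤n) ev) b b∈

      designCuts-valid : ∀ t → t ≤ n → parity (n ∸ t) ≡ 0ℙ → ∀ xs →
                         (∀ {u} → u ∈ᶜ layer (suc t) U → u ∈ xs) → ValidAll xs (designCuts t)
      designCuts-valid t t≤n ev xs layer⊆ = All.map⁺ (All.tabulate λ {R} R∈ →
        let ∣R∣ = ∈-subsets⁻ (suc n) t R∈
            b , b∈ , R⊑b , ∣b∣ = block t t≤n ev R ∣R∣
        in valid-by xs R b (0 ∷ 1 ∷ []) 1 (layer⊆ b∈) R⊑b (trans ∣b∣ (cong suc (sym ∣R∣))))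

      in-U : ∀ {k u} → u ∈ᶜ layer k U → u ∈ᶜ U
      in-U {k} u∈ = proj₁ (∈-filter⁻ (λ v → ∣ v ∣ ≟ k) {xs = vectors U} u∈)

      even⁻ : ∀ {p} → T (even p) → p ≡ 0ℙ
      even⁻ {0ℙ} _ = refl

      layerCut-valid : ∀ {k} → k ∈ upTo (2 + n) → Valid (vectors U) (layerCut k)
      layerCut-valid {k} k∈ with Equivalence.to T-∨ (all-∈ designOK (T≡ designsOK) k∈)
      ... | inj₁ k≡ with ≡ᵇ⇒≡ k (n ∸ 1) k≡
      ...   | refl = follows-valid (vectors U) [] {1} {fill 1 (weightIs (n ∸ 1) (map extendVector l)) []}
                       {layerCut k} (proj₁ (∧⁻ (proj₂ l-OK))) (λ _ ())
                       (fill-valid {k = 1} {ds = []} ext⊆ [])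
        where
        ext⊆ : ∀ {u} → u ∈ weightIs k (map extendVector l) → u ∈ vectors U
        ext⊆ u∈ = in-U {k} (layer-mono k l (vectors D) l⊆D u∈)
      layerCut-valid {k} k∈ | inj₂ r with Equivalence.to (T-∨ {count k ≡ᵇ 0}) r
      ... | inj₁ zero≡ = subst (_≤ total (coef (layerCut k)) (vectors U)) (sym (≡ᵇ⇒≡ (count k) 0 zero≡)) z≤n
      layerCut-valid {suc t} k∈ | inj₂ r | inj₂ ok =
        follows-valid (vectors U) [] {suc t} {designCuts t} {layerCut (suc t)} (proj₂ ok₁) (λ _ ())
          (designCuts-valid t (≤-pred (≤-pred (∈-upTo⁻ k∈))) (even⁻ (proj₁ ok₁)) (vectors U) (in-U {suc t}))
        where ok₁ = ∧⁻ {even (parity (n ∸ t))} (proj₁ (∧⁻ ok))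

      N≤size : N ≤ size D
      N≤size = subst (N ≤_) (length-map extendVector (vectors D)) (sizeCut-valid (vectors U) {N}
        (follows-valid (vectors U) [] {1} {map (λ j → 1 , layerCut j) (upTo (2 + n))} {sizeCut (suc n) N}
          (T≡ sizeOK) (λ _ ())
          (All.map⁺ (All.tabulate layerCut-valid))))

      -- The other layers take up at least `N ∸ count k` of the at most `N` words.
      layer-size : ∀ {k} → k ∈ upTo (2 + n) → length (vectors (layer k U)) ≤ count k
      layer-size {k} k∈ = +-cancelʳ-≤ (N ∸ count k) _ _ (begin
        length (vectors (layer k U)) + (N ∸ count k)                   ≤⟨ +-monoʳ-≤ _ rest ⟩
        length (vectors (layer k U)) + total (coef restCut) (vectors U) ≤⟨ weightIs-size (vectors U) k (N ∸ count k) ⟩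
        length (vectors U)                                             ≡⟨ length-map extendVector (vectors D) ⟩
        size D                                                         ≤⟨ small ⟩
        N                                                              ≡⟨ m+[n∸m]≡n (≤ᵇ⇒≤ (count k) N (proj₂ ok)) ⟨
        count k + (N ∸ count k)                                        ∎)
        where
        open ≤-Reasoning
        restCut = weights (except (suc n) k) (N ∸ count k)
        js = filterᵇ (λ j → not (j ≡ᵇ k)) (upTo (2 + n))
        ds = map (λ j → 1 , layerCut j) js
        ok = ∧⁻ {follows [] 1 ds restCut} (all-∈ restOK (T≡ restsOK) k∈)
        rest : Valid (vectors U) restCut
        rest = follows-valid (vectors U) [] {1} {ds} {restCut} (proj₁ ok) (λ _ ())
          (All.map⁺ (All.tabulate λ {j} j∈ → layerCut-valid
            (proj₁ (∈-filter⁻ (λ j → T? (not (j ≡ᵇ k))) {xs = upTo (2 + n)} j∈))))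

      layer-empty : ∀ {k} → k ∈ upTo (2 + n) → count k ≡ 0 → ∀ {v} → v ∉ vectors (layer k U)
      layer-empty {k} k∈ eq =
        ∉-short (vectors (layer k U)) (subst (length (vectors (layer k U)) ≤_) eq (layer-size k∈))

      -- `ws` is as large as the layer may be, hence is the whole layer.
      layer-iso : ∀ {k} → k ∈ upTo (2 + n) → ∀ ws → T (layerOK k ws) →
                  Unique ws → (∀ {u} → u ∈ ws → u ∈ᶜ layer k U) → layer k U ≅ layer k (extend rep)
      layer-iso {k} k∈ ws ok unique ws⊆ =
        isoᵇ⇒≅ (layer k U) (layer k (extend rep)) ws (proj₂ (∧⁻ {count k ≤ᵇ length ws} ok)) ws⊆
          (saturated unique ws⊆ (≤-trans (layer-size k∈) (≤ᵇ⇒≤ (count k) _ (proj₁ (∧⁻ ok)))))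

      module Steiner (t : ℕ) (k∈ : suc t ∈ upTo (2 + n)) (ok : T (steinerOK (suc t))) where

        k = suc t
        t≤n : t ≤ n
        t≤n = ≤-pred (≤-pred (∈-upTo⁻ k∈))
        B = vectors (layer k U)
        ts = subsets (suc n) t
        ev = even⁻ (proj₁ (∧⁻ {even (parity (n ∸ t))} (proj₁ (∧⁻ ok))))
        dominatedAt : Subset (suc n) → Bool
        dominatedAt u = (combine (designCuts t) u ≤ᵇ k) ∨ not (∣ u ∣ ≡ᵇ k)
        ok₂ = ∧⁻ {(k * count k ≤ᵇ combinedBound (designCuts t)) ∧ allSubsets dominatedAt}
                (proj₂ (∧⁻ {even (parity (n ∸ t)) ∧ follows [] k (designCuts t) (layerCut k)} ok))

        weight-B : ∀ {u} → u ∈ B → ∣ u ∣ ≡ k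
        weight-B u∈ = proj₂ (∈-filter⁻ (λ v → ∣ v ∣ ≟ k) {xs = vectors U} u∈)

        dominated : ∀ {u} → u ∈ B → combine (designCuts t) u ≤ k * 1
        dominated {u} u∈ with Equivalence.to (T-∨ {combine (designCuts t) u ≤ᵇ k})
                                (allSubsets⁻ dominatedAt
                                  (proj₂ (∧⁻ {k * count k ≤ᵇ combinedBound (designCuts t)} (proj₁ ok₂))) u)
        ... | inj₁ le = subst (combine (designCuts t) u ≤_) (sym (*-identityʳ k)) (≤ᵇ⇒≤ _ _ le)
        ... | inj₂ ne = contradiction (≡⇒≡ᵇ ∣ u ∣ k (weight-B u∈)) (subst T (Equivalence.to T-not-≡ ne))

        -- Double counting: at most `count k` blocks, each with at most k sets of size t, leave the
        -- summed covering inequalities no slack, so `tight` applies.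
        once : ∀ {R} → R ∈ ts → total (coef (cut R (0 ∷ 1 ∷ []) 1)) B ≤ 1
        once {R} R∈ = tight B (designCuts t) (designCuts-valid t t≤n ev B id) (begin
          total (combine (designCuts t)) B ≤⟨ total-mono B dominated ⟩
          total (λ _ → k * 1) B            ≡⟨ total-* k (λ _ → 1) B ⟩
          k * total (λ _ → 1) B            ≡⟨ cong (k *_) (total-one B) ⟩
          k * length B                     ≤⟨ *-monoʳ-≤ k (layer-size k∈) ⟩
          k * count k                      ≤⟨ ≤ᵇ⇒≤ _ _ (proj₁ (∧⁻ (proj₁ ok₂))) ⟩
          combinedBound (designCuts t)     ∎) (∈-map⁺ (λ R → 1 , cut R (0 ∷ 1 ∷ []) 1) R∈)
          where open ≤-Reasoning

        one : ∀ {R u} → R ∈ ts → u ∈ B → T (R ⊑ u) → coef (cut R (0 ∷ 1 ∷ []) 1) u ≡ 1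
        one {R} {u} R∈ u∈ R⊑u = coef-⊒ R u (0 ∷ 1 ∷ []) 1 1 R⊑u
          (trans (weight-B u∈) (cong suc (sym (∈-subsets⁻ (suc n) t R∈))))

        disjoint-B : ∀ c {chosen} → Unique (c ∷ chosen) → All (_∈ B) (c ∷ chosen) → T (disjoint ts c chosen)
        disjoint-B c {chosen} (c∉ ∷ _) (c∈ ∷ ch∈) =
          All.all⁻ (λ R → not (R ⊑ c) ∨ not (any (R ⊑_) chosen)) (All.tabulate check)
          where
          check : ∀ {R} → R ∈ ts → T (not (R ⊑ c) ∨ not (any (R ⊑_) chosen))
          check {R} R∈ with R ⊑ c in e₁ | any (R ⊑_) chosen in e₂
          ... | false | _     = tt
          ... | true  | false = tt
          ... | true  | true with find (Any.any⁻ (R ⊑_) chosen (T≡ e₂))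
          ...   | b , b∈ , R⊑b = contradiction (once R∈) (<⇒≱
                  (subst (_≤ total (coef (cut R (0 ∷ 1 ∷ []) 1)) B)
                    (cong₂ _+_ (one R∈ c∈ (T≡ e₁)) (one R∈ (All.lookup ch∈ b∈) R⊑b))
                    (total-∈₂ (coef (cut R (0 ∷ 1 ∷ []) 1)) c∈ (All.lookup ch∈ b∈) (All.lookup c∉ b∈))))
        hit : ∀ {R} → R ∈ ts → ∃[ c ] (c ∈ subsets (suc n) k × T (hits R c) × c ∈ B)
        hit {R} R∈ = let b , b∈ , R⊑b , ∣b∣ = block t t≤n ev R (∈-subsets⁻ (suc n) t R∈)
                     in b , subst (λ w → b ∈ subsets (suc n) w) ∣b∣ (∈-subsets⁺ b) , R⊑b , b∈

        iso : layer k U ≅ layer k (extend rep)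
        iso = let ws , ws∈ , unique , ws⊆ =
                    Search.search-complete hits (disjoint ts) (subsets (suc n) k) (_∈ B) ts hit disjoint-B [] []
              in layer-iso k∈ ws (all-∈ (layerOK k) (proj₂ ok₂) ws∈) unique (All.lookup ws⊆)

      layer-unique : ∀ {k} → k ∈ upTo (2 + n) → (∀ {v} → count k ≡ 0 → v ∉ vectors (layer k (extend rep))) →
                     layer k U ≅ layer k (extend rep)
      layer-unique {k} k∈ rep∅ with Equivalence.to T-∨ (all-∈ designOK (T≡ designsOK) k∈)
      ... | inj₁ k≡ with ≡ᵇ⇒≡ k (n ∸ 1) k≡
      ...   | refl = layer-iso k∈ ws ok
              (distinctᵇ⇒Unique ws (proj₁ (∧⁻ (proj₂ (∧⁻ {count k ≤ᵇ length ws} ok))))) (layer-mono k l (vectors D) l⊆D)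
        where
        ws = weightIs k (map extendVector l)
        ok = proj₂ (∧⁻ {follows [] 1 (fill 1 (weightIs (n ∸ 1) (map extendVector l)) []) (layerCut k)} (proj₂ l-OK))
      layer-unique {k} k∈ rep∅ | inj₂ r with Equivalence.to (T-∨ {count k ≡ᵇ 0}) r
      ... | inj₁ zero≡ = ≅-empty (layer k U) (layer k (extend rep))
                           (λ v∈ → layer-empty k∈ (≡ᵇ⇒≡ (count k) 0 zero≡) v∈) (rep∅ (≡ᵇ⇒≡ (count k) 0 zero≡))
      layer-unique {suc t} k∈ rep∅ | inj₂ r | inj₂ ok = Steiner.iso t k∈ ok

    classified : N ≡ size rep → coveringᵇ (vectors rep) ≡ true → Classified rep
    classified refl repOK = record
      { covering = rep-cov
      ; minimal  = Covering.N≤size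
      ; banded   = Covering.banded
      ; unique   = unique
      }
      where
      rep-cov = coveringᵇ⇒covering rep (T≡ repOK)
      unique : ∀ (D : Code n) → IsAsymmetricCovering D → size D ≤ N → extend D ≅ᵁ extend rep
      unique D cov small k with k <? 2 + n
      ... | yes k< = Covering.layer-unique D cov small (∈-upTo⁺ k<)
                       -- The representative is itself a covering within the budget, so the bounds
                       -- on layers apply to it as well.
                       (λ {v} eq → Covering.layer-empty rep rep-cov ≤-refl (∈-upTo⁺ k<) eq {v})
      ... | no k≮ = ≅-empty (layer k (extend D)) (layer k (extend rep))
                    (empty-layer k (extend D) (≮⇒≥ k≮)) (empty-layer k (extend rep) (≮⇒≥ k≮))

-- Certificates for the lengths 5, 6 and 7.

choose : ∀ {n} → List (Subset n) → (List (Subset n) → Tree n) → Tree n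
choose []       t = t []
choose (u ∷ us) t = branch u (choose us (t ∘ (u ∷_))) (choose us t)

expect : ∀ {n} → List (Subset n) → (Subset n → Tree n) → Tree n → Tree n
expect []       r t = t
expect (u ∷ us) r t = branch u (expect us r t) (r u)

exclude : ∀ {n} → List (Subset n) → (Subset n → Tree n) → Tree n → Tree n
exclude []       r t = t
exclude (u ∷ us) r t = branch u (r u) (exclude us r t)

-- For the case that `u` and all words covering it are absent: the inequality at `u` then reads 0 ≥
-- 1, and `N` times it yields the size `N` that the leaf must show.
uncovered : ∀ {n} → ℕ → Subset n → Tree n
uncovered N u = refute (refutation (u ∷ []) 1 ((N , cover ∣ u ∣ , ∣ u ∣ ∷ []) ∷ []))

-- Applied to the chosen words of weight n - 1, this is the set S of their missing points.
gaps : ∀ {n} → List (Subset n) → Subset n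
gaps = foldr (λ u S → ∁ u ∪ S) ⊥

-- The possible edges inside `S`, as complements.
missingTwo : ∀ {n} → Subset n → List (Subset n)
missingTwo {n} S = filterᵇ (∁ S ⊑_) (subsets n (n ∸ 2))

-- By complements, words of weight n - 4 and n - 5 are sets of four and of five
-- points; the profiles count the sets of four, three and two points inside them.
Q P : ℕ → Family
Q w = w , 1 ∷ 1 ∷ 1 ∷ [] , 3
P w = w , 0 ∷ 1 ∷ 2 ∷ 1 ∷ [] , 9

-- For `Q`, the inequality at the base and the four at its upper neighbours have bounds summing to
-- 5, and 5/2 rounds up to 3. For `P`, the five upper neighbours give 5 · 3 from `Q` and 2 · 5 from
-- `cover`, and 25/3 rounds up to 9.
stepQ stepP : ℕ → Step
stepQ w = step (Q w) 2 ((1 , cover w , w ∷ []) ∷ (1 , cover (suc w) , w ∷ []) ∷ [])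
stepP w = step (P w) 3 ((1 , Q (suc w) , w ∷ []) ∷ (2 , cover (suc w) , w ∷ []) ∷ [])

light : ℕ → ℕ → Family
light k b = 0 , List.replicate k 1 , b

-- For length 7: the bound `light 3 4` of length 6, carried over to the words through a point.
point : Family
point = 1 , 1 ∷ 1 ∷ 1 ∷ [] , 4

topTree : ∀ {n} → ℕ → (ℕ → Subset n → Tree n) → Tree n
topTree {n} N t = expect (⊤ ∷ []) (uncovered N) (choose (subsets n (n ∸ 1)) λ us →
  -- A word missing two points outside S is not covered, as both words above it are absent; so it is
  -- present.
  let S = gaps us in expect (missingTwo (∁ S)) (uncovered N) (t (length us) S))

-- The multipliers below solve the duals of the linear programs which minimise
-- the size in each case; they were found by computer.

script5 : List Step
script5 =
  stepQ 1 ∷ stepP 0 ∷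
  step (light 3 3) 2 ((1 , cover 1 , []) ∷ (1 , cover 0 , []) ∷ []) ∷
  step (light 4 7) 4 ((2 , cover 0 , []) ∷ (1 , Q 1 , []) ∷ (1 , P 0 , []) ∷ []) ∷ []

tree5 : Tree 5
-- 11 is one more than the minimum. For |S| ≤ 1 the full word, the words of weight 4 and the clique
-- outside S are at least 8 words, and `light 3 3` adds 3.
tree5 = topTree 11 λ where
  0 S → refute (refutation [] 1 ((1 , light 3 3 , []) ∷ []))
  1 S → refute (refutation [] 1 ((1 , light 3 3 , []) ∷ []))
  2 S → expect (missingTwo S)
    (λ u → refute (refutation (S ∷ ∁ S ∷ []) 2
      ((1 , cover 0 , []) ∷ (1 , cover 1 , 1 ∷ 0 ∷ []) ∷ (1 , Q 1 , 0 ∷ 1 ∷ []) ∷ []))) accept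
  -- Here |S| ≥ 3: at least four words have weight 4 or more, and 4 + 7 = 11.
  _ S → refute (refutation [] 1 ((1 , light 4 7 , []) ∷ []))

script6 : List Step
script6 =
  stepQ 2 ∷ stepP 1 ∷
  step (light 3 4) 2 ((1 , cover 1 , []) ∷ (1 , cover 0 , []) ∷ []) ∷
  step (light 4 8) 3 ((1 , cover 2 , []) ∷ (1 , cover 0 , []) ∷ (2 , light 3 4 , []) ∷ []) ∷
  step (light 5 14) 24 ((8 , cover 0 , []) ∷ (2 , Q 2 , []) ∷ (3 , P 1 , []) ∷ (16 , light 3 4 , []) ∷ []) ∷ []

tree6 : Tree 6
tree6 = topTree 19 λ where
  0 S → refute (refutation [] 1 ((1 , light 4 8 , []) ∷ []))
  1 S → refute (refutation [] 1 ((1 , light 4 8 , []) ∷ []))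
  2 S → expect (missingTwo S)
    (λ u → refute (refutation (S ∷ ∁ S ∷ []) 2
      ((1 , cover 2 , 1 ∷ 1 ∷ []) ∷ (2 , cover 3 , 0 ∷ 3 ∷ []) ∷ (1 , light 3 4 , []) ∷ []))) accept
  -- A missing edge e of S alone is no contradiction for the linear program: it
  -- is once the edges between e and the complement of S are decided as well.
  3 S → expect (missingTwo S)
    (λ e → exclude (filterᵇ (λ u → (meet u (∁ e) ≡ᵇ 1) ∧ (meet u (∁ S) ≡ᵇ 2)) (subsets 6 4))
      -- The blocks: the common end of the two pairs missing from `e` and `u`, the other end of `e`,
      -- the third point of S, the end of `u` outside S, and the two remaining points.
      (λ u → refute (refutation (∁ u ∩ ∁ e ∷ u ∩ ∁ e ∷ S ∩ e ∷ ∁ (u ∪ S) ∷ u ∩ ∁ S ∷ []) 6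
        ( (2 , cover 0 , [])
        ∷ (2 , cover 2 , 1 ∷ 1 ∷ 0 ∷ 0 ∷ 0 ∷ []) ∷ (2 , cover 2 , 1 ∷ 0 ∷ 1 ∷ 0 ∷ 0 ∷ [])
        ∷ (2 , cover 2 , 1 ∷ 0 ∷ 0 ∷ 1 ∷ 0 ∷ []) ∷ (2 , cover 2 , 0 ∷ 1 ∷ 1 ∷ 0 ∷ 0 ∷ [])
        ∷ (1 , cover 2 , 0 ∷ 1 ∷ 0 ∷ 0 ∷ 1 ∷ []) ∷ (1 , cover 2 , 0 ∷ 0 ∷ 1 ∷ 0 ∷ 1 ∷ [])
        ∷ (1 , Q 2 , 1 ∷ 0 ∷ 0 ∷ 0 ∷ 1 ∷ []) ∷ (2 , Q 2 , 0 ∷ 1 ∷ 0 ∷ 1 ∷ 0 ∷ [])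
        ∷ (2 , Q 2 , 0 ∷ 0 ∷ 1 ∷ 1 ∷ 0 ∷ []) ∷ (1 , Q 2 , 0 ∷ 0 ∷ 0 ∷ 1 ∷ 1 ∷ [])
        ∷ (1 , P 1 , 0 ∷ 0 ∷ 0 ∷ 0 ∷ 1 ∷ []) ∷ (4 , light 3 4 , []) ∷ [])))
      (refute (refutation (∁ e ∷ S ∩ e ∷ ∁ S ∷ []) 4
        ( (2 , cover 0 , []) ∷ (2 , cover 1 , 0 ∷ 1 ∷ 0 ∷ []) ∷ (2 , cover 1 , 0 ∷ 0 ∷ 1 ∷ [])
        ∷ (2 , cover 2 , 1 ∷ 1 ∷ 0 ∷ []) ∷ (1 , cover 2 , 1 ∷ 0 ∷ 1 ∷ [])
        ∷ (4 , cover 3 , 0 ∷ 1 ∷ 2 ∷ []) ∷ (1 , cover 3 , 0 ∷ 0 ∷ 3 ∷ [])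
        ∷ (1 , Q 2 , 1 ∷ 0 ∷ 1 ∷ []) ∷ []))))
    accept
  _ S → refute (refutation [] 1 ((1 , light 5 14 , []) ∷ []))

script7 : List Step
script7 =
  stepQ 3 ∷ stepP 2 ∷
  step point 2 ((1 , cover 2 , 1 ∷ []) ∷ (1 , cover 1 , 1 ∷ []) ∷ []) ∷
  step (light 3 4) 2 ((1 , cover 1 , []) ∷ (1 , cover 0 , []) ∷ []) ∷
  step (light 4 11) 3 ((1 , cover 0 , []) ∷ (1 , point , []) ∷ (1 , light 3 4 , []) ∷ []) ∷
  step (light 5 18) 4 ((1 , cover 3 , []) ∷ (1 , light 3 4 , []) ∷ (3 , light 4 11 , []) ∷ []) ∷
  step (light 6 27) 40 ((1 , Q 3 , []) ∷ (3 , P 2 , []) ∷ (10 , light 3 4 , []) ∷ (30 , light 4 11 , []) ∷ []) ∷ []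

tree7 : Tree 7
tree7 = topTree 32 λ where
  0 S → refute (refutation [] 1 ((1 , light 5 18 , []) ∷ []))
  1 S → refute (refutation [] 1 ((1 , light 5 18 , []) ∷ []))
  2 S → refute (refutation (S ∷ ∁ S ∷ []) 30
    ( (1 , cover 3 , 2 ∷ 1 ∷ []) ∷ (2 , cover 3 , 1 ∷ 2 ∷ []) ∷ (6 , cover 4 , 0 ∷ 4 ∷ [])
    ∷ (4 , light 4 11 , []) ∷ (24 , light 5 18 , []) ∷ []))
  3 S → expect (missingTwo S)
    (λ e → refute (refutation (∁ e ∷ S ∩ e ∷ ∁ S ∷ []) 6
      ( (1 , cover 3 , 2 ∷ []) ∷ (2 , cover 3 , 1 ∷ 1 ∷ 1 ∷ []) ∷ (2 , cover 3 , 1 ∷ 0 ∷ 2 ∷ [])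
      ∷ (6 , cover 4 , 0 ∷ []) ∷ (2 , light 3 4 , []) ∷ (4 , light 4 11 , []) ∷ [])))
    accept
  _ S → refute (refutation [] 1 ((1 , light 6 27 , []) ∷ []))

low5 low6 low7 : ℕ → Maybe Low
-- Three words of weight 2, seven of weight at least 3 and the zero word make 11, one too many.
low5 0 = just (rule 3 1 1 1 ((1 , cover 0 , []) ∷ []))
low5 _ = nothing
low6 1 = just (rule 3 3 2 3 ((1 , cover 2 , 0 ∷ []) ∷ (2 , light 3 4 , []) ∷ (1 , cover 0 , []) ∷ []))
low6 _ = nothing
low7 0 = just (rule 4 4 1 4 ((1 , cover 3 , []) ∷ (1 , cover 0 , []) ∷ (3 , light 4 11 , []) ∷ []))
low7 2 = just (rule 3 4 2 4
  ((1 , cover 3 , 0 ∷ []) ∷ (1 , cover 3 , 1 ∷ []) ∷ (1 , light 3 4 , []) ∷ (3 , light 4 11 , []) ∷ []))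
low7 _ = nothing

-- the covering numbers C(n + 1, k, k - 1) for even co-weight and k > 0, by k
counts5 counts6 counts7 : List ℕ
counts5 = 0 ∷ 0 ∷ 3 ∷ 0 ∷ 6 ∷ 0 ∷ 1 ∷ []
counts6 = 0 ∷ 1 ∷ 0 ∷ 7 ∷ 0 ∷ 9 ∷ 0 ∷ 1 ∷ []
counts7 = 0 ∷ 0 ∷ 4 ∷ 0 ∷ 14 ∷ 0 ∷ 12 ∷ 0 ∷ 1 ∷ []

-- Extended, layer 4 consists of the complements of the edges of two disjoint triangles and layer 2
-- is a perfect matching.
rep5 : Code 5
rep5 = code 5
  ( 0b11111 ∷ 0b11101 ∷ 0b11110 ∷ 0b00111 ∷ 0b01011 ∷ 0b10011 ∷ 0b11100
  ∷ 0b00011 ∷ 0b01100 ∷ 0b10000 ∷ [])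

-- Extended, layer 5 comes in the same way from a disjoint triangle and K4, layer 3 is the Fano
-- plane and layer 1 a single point.
rep6 : Code 6
rep6 = code 6
  ( 0b111111 ∷ 0b111101 ∷ 0b111110 ∷ 0b001111 ∷ 0b010111 ∷ 0b100111
  ∷ 0b011011 ∷ 0b101011 ∷ 0b110011 ∷ 0b111100
  ∷ 0b000111 ∷ 0b011001 ∷ 0b101010 ∷ 0b110100 ∷ 0b100001 ∷ 0b010010 ∷ 0b001100
  ∷ 0b000001 ∷ [])

-- Extended, layer 6 comes from two disjoint K4, layer 4 is the Steiner quadruple system on 8 points
-- and layer 2 a perfect matching.
rep7 : Code 7
rep7 = code 7
  ( 0b1111111 ∷ 0b1111011 ∷ 0b1111101 ∷ 0b1111110 ∷ 0b0011111 ∷ 0b0101111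
  ∷ 0b1001111 ∷ 0b0110111 ∷ 0b1010111 ∷ 0b1100111 ∷ 0b1111001 ∷ 0b1111010 ∷ 0b1111100
  ∷ 0b0001111 ∷ 0b0110011 ∷ 0b1010101 ∷ 0b1101001 ∷ 0b1100110 ∷ 0b1011010 ∷ 0b0111100
  ∷ 0b1000011 ∷ 0b0100101 ∷ 0b0011001 ∷ 0b0010110 ∷ 0b0101010 ∷ 0b1001100 ∷ 0b1110000
  ∷ 0b0000011 ∷ 0b0001100 ∷ 0b0110000 ∷ 0b1000000 ∷ [])

-- Length 4

allSubsets⁺ : ∀ {n} (p : Subset n → Bool) → (∀ v → T (p v)) → T (allSubsets p)
allSubsets⁺ {zero}  p t = t []
allSubsets⁺ {suc n} p t = Equivalence.from T-∧
  (allSubsets⁺ (λ v → p (false ∷ v)) (λ v → t (false ∷ v)) , allSubsets⁺ (λ v → p (true ∷ v)) (λ v → t (true ∷ v)))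

odd⁻ : ∀ {n} (v : Subset n) → T (odd v) → parity (coweight v) ≡ 1ℙ
odd⁻ v t with parity (coweight v)
... | 1ℙ = refl

banded⇒bandedᵇ : ∀ {n} (D : Code n) {l} → (∀ {u} → u ∈ᶜ D → u ∈ l) → IsBanded D → T (bandedᵇ l)
banded⇒bandedᵇ D {l} D⊆l banded = allSubsets⁺ (λ v → not (odd v) ∨ any (above v) l) covered
  where
  covered : ∀ v → T (not (odd v) ∨ any (above v) l)
  covered v with odd v in eq
  ... | false = tt
  ... | true with banded v (odd⁻ v (T≡ eq))
  ...   | u , u∈ , v⊆u , ∣u∣ = Any.any⁺ (above v) (Any.map (λ where refl → is-above) (D⊆l u∈))
    where
    is-above : T (above v u)
    is-above = Equivalence.from T-∧ (⊆⇒⊑ v u v⊆u , ≡⇒≡ᵇ ∣ u ∣ (suc ∣ v ∣) (trans ∣u∣ (+-comm ∣ v ∣ 1)))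

allVecs : ∀ {m} k → (Vec (Fin m) k → Bool) → Bool
allVecs     zero    p = p []
allVecs {m} (suc k) p = all (λ i → allVecs k (λ ρ → p (i ∷ ρ))) (allFin m)

allVecs⁻ : ∀ {m} k (p : Vec (Fin m) k → Bool) → T (allVecs k p) → ∀ ρ → T (p ρ)
allVecs⁻ zero    p t []      = t
allVecs⁻ (suc k) p t (i ∷ ρ) = allVecs⁻ k (λ ρ → p (i ∷ ρ))
  (all-∈ (λ i → allVecs k (λ ρ → p (i ∷ ρ))) t (∈-allFin i)) ρ

-- All m^m maps of the coordinates are tried; injectivity is evaluated only for those that carry `l`
-- into `r`.
separated : ∀ {m} → List (Subset m) → List (Subset m) → Bool
separated {m} l r = allVecs m λ ρ → not (all (λ v → reorder ρ v ∈ᵇ r) l) ∨ not (isYes (injective? ρ))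

separated⇒≇ : ∀ {m} (B C : Code m) → T (separated (vectors B) (vectors C)) → ¬ (B ≅ C)
separated⇒≇ {m} B C sep (π , iso) = [ refuted maps , refuted (fromWitness {a? = injective? ρ} inj) ]′
  (Equivalence.to T-∨ (allVecs⁻ m
    (λ ρ → not (all (λ v → reorder ρ v ∈ᵇ vectors C) (vectors B)) ∨ not (isYes (injective? ρ))) sep ρ))
  where
  ρ = tabulate (π ⟨$⟩ʳ_)
  refuted : ∀ {b} → T b → ¬ T (not b)
  refuted {true} _ ()
  maps : T (all (λ v → reorder ρ v ∈ᵇ vectors C) (vectors B))
  maps = All.all⁻ (λ v → reorder ρ v ∈ᵇ vectors C) (All.tabulate λ {v} v∈ → ∈⇒∈ᵇ
    (subst (_∈ vectors C) (tabulate-∘ (lookup v) (π ⟨$⟩ʳ_)) (Equivalence.to (iso v) v∈)))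
  inj : ∀ i j → lookup ρ i ≡ lookup ρ j → i ≡ j
  inj i j eq = begin
    i                                ≡⟨ Perm.inverseˡ π ⟨
    π ⟨$⟩ˡ (π ⟨$⟩ʳ i)      ≡⟨ cong (π ⟨$⟩ˡ_) (trans (sym (lookup∘tabulate _ i)) (trans eq (lookup∘tabulate _ j))) ⟩
    π ⟨$⟩ˡ (π ⟨$⟩ʳ j)      ≡⟨ Perm.inverseˡ π ⟩
    j                                ∎
    where open ≡-Reasoning

module Representatives {n k : ℕ} (N : ℕ) (rep : Fin (suc k) → Code n) (sizes : ∀ i → size (rep i) ≡ N) where

  open Small {n} N using (coverings; coverings-complete)

  matches : List (Subset n) → Bool
  matches l = any (λ i → isoᵇ (map extendVector l) (vectors (extend (rep i)))) (allFin (suc k))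

  apart : Fin (suc k) → Fin (suc k) → Bool
  apart i j = does (i Fin.≟ j) ∨ separated (vectors (extend (rep i))) (vectors (extend (rep j)))

  module _ (coveringsOK : all (λ l → N ≤ᵇ length l) coverings ≡ true)
           (repsOK : all (λ i → coveringᵇ (vectors (rep i))) (allFin (suc k)) ≡ true)
           (apartOK : all (λ i → all (apart i) (allFin (suc k))) (allFin (suc k)) ≡ true) where

    minimum : ∀ i → IsMinimum (rep i)
    minimum i = smallest (rep i)
      (coveringᵇ⇒covering (rep i) (all-∈ (λ i → coveringᵇ (vectors (rep i))) (T≡ repsOK) (∈-allFin i)))
      λ D cov small →
        let _ , _ , _ , _ , N≤ = coverings-complete (T≡ coveringsOK) D cov (subst (size D ≤_) (sizes i) small)
        in subst (_≤ size D) (sym (sizes i)) N≤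

    minimum-size : ∀ {D : Code n} → IsMinimum D → size D ≤ N
    -- Any representative shows that the size `N` is attained; the index type `Fin (suc k)` provides
    -- one.
    minimum-size {D} (_ , min) = subst (size D ≤_) (sizes Fin.zero) (min (rep Fin.zero) (proj₁ (minimum Fin.zero)))

    inequivalent : ∀ i j → rep i ≅ᴱ rep j → i ≡ j
    inequivalent i j iso = go (i Fin.≟ j)
      (all-∈ (apart i) (all-∈ (λ i → all (apart i) (allFin (suc k))) (T≡ apartOK) (∈-allFin i)) (∈-allFin j))
      where
      go : ∀ (d : Dec (i ≡ j)) → T (does d ∨ separated (vectors (extend (rep i))) (vectors (extend (rep j)))) → i ≡ j
      go (yes i≡j) _   = i≡j
      go (no _)    sep = contradiction iso (separated⇒≇ (extend (rep i)) (extend (rep j)) sep)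

    matches⇒≅ᴱ : ∀ (D : Code n) l → T (matches l) →
                 (∀ {u} → u ∈ l → u ∈ᶜ D) → (∀ {u} → u ∈ᶜ D → u ∈ l) → ∃[ i ] (D ≅ᴱ rep i)
    matches⇒≅ᴱ D l t l⊆D D⊆l =
      let i , iso = Any.satisfied
            (Any.any⁻ (λ i → isoᵇ (map extendVector l) (vectors (extend (rep i)))) (allFin (suc k)) t)
      in i , isoᵇ⇒≅ (extend D) (extend (rep i)) (map extendVector l) iso
               (Subset.map⁺ extendVector l⊆D) (Subset.map⁺ extendVector D⊆l)

    classes : all matches coverings ≡ true → ClassCount _≅ᴱ_ IsMinimum (suc k)
    classes matchesOK = record
      { rep          = rep
      ; rep-P        = minimum
      ; inequivalent = inequivalent
      ; complete     = λ D min →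
          let l , l∈ , l⊆D , D⊆l , _ = coverings-complete (T≡ coveringsOK) D (proj₁ min) (minimum-size {D} min)
          in matches⇒≅ᴱ D l (all-∈ matches (T≡ matchesOK) l∈) l⊆D D⊆l
      }

    bandedClasses : all (λ i → bandedᵇ (vectors (rep i))) (allFin (suc k)) ≡ true →
                    all (λ l → not (bandedᵇ l) ∨ matches l) coverings ≡ true →
                    ClassCount _≅ᴱ_ (λ D → IsMinimum D × IsBanded D) (suc k)
    bandedClasses bandedOK matchesOK = record
      { rep          = rep
      ; rep-P        = λ i → minimum i ,
          bandedᵇ⇒banded (rep i) id (all-∈ (λ i → bandedᵇ (vectors (rep i))) (T≡ bandedOK) (∈-allFin i))
      ; inequivalent = inequivalent
      ; complete     = λ where
          D (min , banded) →
            let l , l∈ , l⊆D , D⊆l , _ = coverings-complete (T≡ coveringsOK) D (proj₁ min) (minimum-size {D} min)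
            in matches⇒≅ᴱ D l (implied (all-∈ (λ l → not (bandedᵇ l) ∨ matches l) (T≡ matchesOK) l∈)
                                       (banded⇒bandedᵇ D D⊆l banded)) l⊆D D⊆l
      }

-- The banded ones come first, so that the embedding of `Fin 2` selects the two banded classes.
rep4 : Fin 4 → Code 4
rep4 0F = code 4 (0b1111 ∷ 0b1110 ∷ 0b0011 ∷ 0b0101 ∷ 0b1001 ∷ 0b0000 ∷ [])
rep4 1F = code 4 (0b1111 ∷ 0b0111 ∷ 0b1011 ∷ 0b0011 ∷ 0b1100 ∷ 0b0000 ∷ [])
rep4 2F = code 4 (0b1111 ∷ 0b0111 ∷ 0b1011 ∷ 0b1100 ∷ 0b0001 ∷ 0b0010 ∷ [])
rep4 3F = code 4 (0b1111 ∷ 0b0111 ∷ 0b1101 ∷ 0b0110 ∷ 0b1010 ∷ 0b0001 ∷ [])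

sizes4 : ∀ i → size (rep4 i) ≡ 6
sizes4 0F = refl
sizes4 1F = refl
sizes4 2F = refl
sizes4 3F = refl

classes4 : ClassCount _≅ᴱ_ IsMinimum 4
classes4 = Representatives.classes 6 rep4 sizes4 refl refl refl refl

bandedClasses4 : ClassCount _≅ᴱ_ (λ D → IsMinimum D × IsBanded D) 2
bandedClasses4 = Representatives.bandedClasses 6
  (λ i → rep4 (i Fin.↑ˡ 2)) (λ i → sizes4 (i Fin.↑ˡ 2)) refl refl refl refl refl

-- The lengths other than 4, by evaluation of the checks, and the conclusion.

classified1 : Classified (code 1 (0b1 ∷ []))
classified1 = Small.classified 1 _ refl refl refl refl

classified2 : Classified (code 2 (0b11 ∷ 0b01 ∷ []))
classified2 = Small.classified 2 _ refl refl refl refl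

classified3 : Classified (code 3 (0b111 ∷ 0b011 ∷ 0b100 ∷ []))
classified3 = Small.classified 3 _ refl refl refl refl

classified5 : Classified rep5
classified5 = Large.classified 10 script5 tree5 low5 counts5 rep5 refl refl refl refl refl refl refl refl refl

classified6 : Classified rep6
classified6 = Large.classified 18 script6 tree6 low6 counts6 rep6 refl refl refl refl refl refl refl refl refl

classified7 : Classified rep7
classified7 = Large.classified 31 script7 tree7 low7 counts7 rep7 refl refl refl refl refl refl refl refl refl

theorem4 : ((n : ℕ) → n ∈ 1 ∷ 2 ∷ 3 ∷ 5 ∷ 6 ∷ 7 ∷ [] →
    ((D : Code n) → IsMinimum D → IsBanded D × IsUnionOfCoveringDesigns (extend D)) ×
    ClassCount _≅ᵁ_ (IsMinimumUnion {n}) 1) ×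
    (MinimumSizeIs 4 6 ×
    ClassCount (_≅ᴱ_ {4}) IsMinimum 4 ×
    ClassCount (_≅ᴱ_ {4}) (λ D → IsMinimum D × IsBanded D) 2)
theorem4 = others , (rep4 0F , ClassCount.rep-P classes4 0F , refl) , classes4 , bandedClasses4
  where
  others : ∀ n → n ∈ 1 ∷ 2 ∷ 3 ∷ 5 ∷ 6 ∷ 7 ∷ [] →
    ((D : Code n) → IsMinimum D → IsBanded D × IsUnionOfCoveringDesigns (extend D)) ×
    ClassCount _≅ᵁ_ (IsMinimumUnion {n}) 1
  others _ (here refl)                                         = classify classified1
  others _ (there (here refl))                                 = classify classified2
  others _ (there (there (here refl)))                         = classify classified3
  others _ (there (there (there (here refl))))                 = classify classified5
  others _ (there (there (there (there (here refl)))))         = classify classified6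
  others _ (there (there (there (there (there (here refl)))))) = classify classified7
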